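{- Let $k\ge 2$ be an integer and let $x$ be a real number with $x\ge (10^8\log k)/2$. There exists a tournament $R$ with vertex set $[k]=\{1,\dots,k\}$ such that for all pairs of weight functions $f,g:[k]\to[0,1]$ with $f+g\le 1$ (pointwise) and $\sum_{i=1}^k (f(i)+g(i))=2x$, we have $$\sum_{ij\in E(R)} f(i)g(j)\le 0.51x^2.$$
   Context: A tournament with vertex set $[k]$ is an orientation of the edges of the complete graph on $[k]$; $ij\in E(R)$ means that the edge between $i$ and $j$ is directed from $i$ to $j$. Logarithms are to base $e$. -}

module Defs where

open import Data.Bool.Base using (Bool; false; not; if_then_else_)
open import Data.Fin.Base using (Fin)
open import Data.Integer.Base using (+_)
import Data.Integer.Base as ℤ
import Data.Integer.Properties as ℤP
import Data.Integer.Tactic.RingSolver as ℤSolver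
open import Data.Nat.Base using (ℕ; zero; suc; s≤s)
import Data.Nat.Base as ℕ
import Data.Nat.Properties as ℕP
import Data.Nat.Tactic.RingSolver as ℕSolver
open import Data.Product.Base using (∃-syntax; _×_; _,_; proj₁; proj₂)
open import Data.Rational.Base using (ℚ; mkℚ; 0ℚ; 1ℚ; ½; _/_; ∣_∣; 1/_; positive; nonNegative)
import Data.Rational.Base as ℚ
import Data.Rational.Properties as ℚP
import Data.Rational.Solver as ℚSolver
import Data.Rational.Unnormalised.Base as ℚᵘ
import Data.Rational.Unnormalised.Properties as ℚᵘP
open import Data.Sum.Base using (inj₁; inj₂)
open import Data.Vec.Functional using (foldr)
open import Relation.Binary.PropositionalEquality using (_≡_; _≢_; refl; sym; trans; cong; cong₂; subst)

------------------------------------------------------------------------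
-- Real numbers: Cauchy sequences of rationals, as a setoid under _≃_

IsCauchy : (ℕ → ℚ) → Set
IsCauchy s = ∀ ε → 0ℚ ℚ.< ε →
  ∃[ N ] (∀ m n → N ℕ.≤ m → N ℕ.≤ n → ∣ s m ℚ.- s n ∣ ℚ.≤ ε)

record ℝ : Set where
  constructor mkℝ
  field
    seq    : ℕ → ℚ
    cauchy : IsCauchy seq

open ℝ public

infix 4 _≤_ _≃_

_≤_ : ℝ → ℝ → Set
x ≤ y = ∀ ε → 0ℚ ℚ.< ε → ∃[ N ] (∀ n → N ℕ.≤ n → seq x n ℚ.≤ seq y n ℚ.+ ε)

_≃_ : ℝ → ℝ → Set
x ≃ y = x ≤ y × y ≤ x

fromℚ : ℚ → ℝ
fromℚ q = mkℝ (λ _ → q) λ ε 0<ε → 0 , λ _ _ _ _ →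
  subst (ℚ._≤ ε) (sym (cong ∣_∣ (ℚP.+-inverseʳ q))) (ℚP.<⇒≤ 0<ε)

0ℝ 1ℝ : ℝ
0ℝ = fromℚ 0ℚ
1ℝ = fromℚ 1ℚ

module Halving where
  half-pos : ∀ {ε} → 0ℚ ℚ.< ε → 0ℚ ℚ.< ½ ℚ.* ε
  half-pos {ε} 0<ε = ℚP.positive⁻¹ _ {{ℚP.pos*pos⇒pos ½ ε {{positive 0<ε}}}}

  halves : ∀ ε → ½ ℚ.* ε ℚ.+ ½ ℚ.* ε ≡ ε
  halves ε = trans (sym (ℚP.*-distribʳ-+ ε ½ ½)) (ℚP.*-identityˡ ε)

open Halving

+-cauchy : ∀ {s t} → IsCauchy s → IsCauchy t → IsCauchy (λ n → s n ℚ.+ t n)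
+-cauchy {s} {t} cs ct ε 0<ε = M ℕ.⊔ N , λ m n M⊔N≤m M⊔N≤n → begin
    ∣ (s m ℚ.+ t m) ℚ.- (s n ℚ.+ t n) ∣       ≡⟨ cong ∣_∣ (rearrange (s m) (t m) (s n) (t n)) ⟩
    ∣ (s m ℚ.- s n) ℚ.+ (t m ℚ.- t n) ∣       ≤⟨ ℚP.∣p+q∣≤∣p∣+∣q∣ (s m ℚ.- s n) (t m ℚ.- t n) ⟩
    ∣ s m ℚ.- s n ∣ ℚ.+ ∣ t m ℚ.- t n ∣       ≤⟨ ℚP.+-mono-≤
                                                  (proj₂ S m n (ℕP.≤-trans (ℕP.m≤m⊔n M N) M⊔N≤m) (ℕP.≤-trans (ℕP.m≤m⊔n M N) M⊔N≤n))
                                                  (proj₂ T m n (ℕP.≤-trans (ℕP.m≤n⊔m M N) M⊔N≤m) (ℕP.≤-trans (ℕP.m≤n⊔m M N) M⊔N≤n)) ⟩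
    ½ ℚ.* ε ℚ.+ ½ ℚ.* ε                       ≡⟨ halves ε ⟩
    ε                                         ∎
  where
  open ℚP.≤-Reasoning
  open ℚSolver.+-*-Solver
  S = cs (½ ℚ.* ε) (half-pos 0<ε)
  T = ct (½ ℚ.* ε) (half-pos 0<ε)
  M = proj₁ S
  N = proj₁ T
  rearrange : ∀ a b c d → (a ℚ.+ b) ℚ.- (c ℚ.+ d) ≡ (a ℚ.- c) ℚ.+ (b ℚ.- d)
  rearrange = solve 4 (λ a b c d → (a :+ b) :- (c :+ d) := (a :- c) :+ (b :- d)) refl

eventuallyBounded : ∀ {s} → IsCauchy s → ∃[ B ] (0ℚ ℚ.< B × ∃[ N ] (∀ n → N ℕ.≤ n → ∣ s n ∣ ℚ.≤ B))
eventuallyBounded {s} cs = ∣ s N ∣ ℚ.+ 1ℚ , 0<B , N , λ n N≤n → begin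
    ∣ s n ∣                          ≡⟨ cong ∣_∣ (split (s n) (s N)) ⟩
    ∣ s N ℚ.+ (s n ℚ.- s N) ∣        ≤⟨ ℚP.∣p+q∣≤∣p∣+∣q∣ (s N) (s n ℚ.- s N) ⟩
    ∣ s N ∣ ℚ.+ ∣ s n ℚ.- s N ∣      ≤⟨ ℚP.+-monoʳ-≤ ∣ s N ∣ (proj₂ C n N N≤n ℕP.≤-refl) ⟩
    ∣ s N ∣ ℚ.+ 1ℚ                   ∎
  where
  open ℚP.≤-Reasoning
  open ℚSolver.+-*-Solver
  C = cs 1ℚ (ℚP.positive⁻¹ 1ℚ)
  N = proj₁ C
  0<B : 0ℚ ℚ.< ∣ s N ∣ ℚ.+ 1ℚ
  0<B = ℚP.+-mono-≤-< (ℚP.0≤∣p∣ (s N)) (ℚP.positive⁻¹ 1ℚ)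
  split : ∀ a b → a ≡ b ℚ.+ (a ℚ.- b)
  split = solve 2 (λ a b → a := b :+ (a :- b)) refl

module Scaling where
  scale : ∀ C ε → 0ℚ ℚ.< C → 0ℚ ℚ.< ε → ∃[ δ ] (0ℚ ℚ.< δ × C ℚ.* δ ≡ ε)
  scale C ε 0<C 0<ε = 1/C ℚ.* ε
    , ℚP.positive⁻¹ _ {{ℚP.pos*pos⇒pos 1/C {{ℚP.1/pos⇒pos C {{positive 0<C}}}} ε {{positive 0<ε}}}}
    , trans (sym (ℚP.*-assoc C 1/C ε))
        (trans (cong (ℚ._* ε) (ℚP.*-inverseʳ C {{ℚP.pos⇒nonZero C {{positive 0<C}}}})) (ℚP.*-identityˡ ε))
    where
    1/C = (1/ C) {{ℚP.pos⇒nonZero C {{positive 0<C}}}}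

  product-bound : ∀ p q {D δ} → 0ℚ ℚ.< D → ∣ p ∣ ℚ.≤ D → ∣ q ∣ ℚ.≤ δ → ∣ p ℚ.* q ∣ ℚ.≤ D ℚ.* δ
  product-bound p q {D} {δ} 0<D p≤D q≤δ = begin
    ∣ p ℚ.* q ∣       ≡⟨ ℚP.∣p*q∣≡∣p∣*∣q∣ p q ⟩
    ∣ p ∣ ℚ.* ∣ q ∣   ≤⟨ ℚP.*-monoʳ-≤-nonNeg ∣ q ∣ {{nonNegative (ℚP.0≤∣p∣ q)}} p≤D ⟩
    D ℚ.* ∣ q ∣       ≤⟨ ℚP.*-monoˡ-≤-nonNeg D {{nonNegative (ℚP.<⇒≤ 0<D)}} q≤δ ⟩
    D ℚ.* δ           ∎
    where open ℚP.≤-Reasoning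

  product-difference : ∀ a b c d → a ℚ.* b ℚ.- c ℚ.* d ≡ a ℚ.* (b ℚ.- d) ℚ.+ d ℚ.* (a ℚ.- c)
  product-difference = solve 4 (λ a b c d → a :* b :- c :* d := a :* (b :- d) :+ d :* (a :- c)) refl
    where open ℚSolver.+-*-Solver

open Scaling

*-cauchy : ∀ {s t} → IsCauchy s → IsCauchy t → IsCauchy (λ n → s n ℚ.* t n)
*-cauchy {s} {t} cs ct ε 0<ε =
  let A , 0<A , K , s≤A = eventuallyBounded {s} cs
      B , 0<B , L , t≤B = eventuallyBounded {t} ct
      δ , 0<δ , [A+B]δ≡ε = scale (A ℚ.+ B) ε (ℚP.+-mono-< 0<A 0<B) 0<ε
      M , s-close = cs δ 0<δ
      N , t-close = ct δ 0<δ
  in (K ℕ.⊔ L) ℕ.⊔ (M ℕ.⊔ N) , λ m n P≤m P≤n →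
    let K≤m = ℕP.m⊔n≤o⇒m≤o K L (ℕP.m⊔n≤o⇒m≤o _ (M ℕ.⊔ N) P≤m)
        L≤n = ℕP.m⊔n≤o⇒n≤o K L (ℕP.m⊔n≤o⇒m≤o _ (M ℕ.⊔ N) P≤n)
        M⊔N≤m = ℕP.m⊔n≤o⇒n≤o (K ℕ.⊔ L) _ P≤m
        M⊔N≤n = ℕP.m⊔n≤o⇒n≤o (K ℕ.⊔ L) _ P≤n
    in begin
    ∣ s m ℚ.* t m ℚ.- s n ℚ.* t n ∣
      ≡⟨ cong ∣_∣ (product-difference (s m) (t m) (s n) (t n)) ⟩
    ∣ s m ℚ.* (t m ℚ.- t n) ℚ.+ t n ℚ.* (s m ℚ.- s n) ∣
      ≤⟨ ℚP.∣p+q∣≤∣p∣+∣q∣ (s m ℚ.* (t m ℚ.- t n)) (t n ℚ.* (s m ℚ.- s n)) ⟩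
    ∣ s m ℚ.* (t m ℚ.- t n) ∣ ℚ.+ ∣ t n ℚ.* (s m ℚ.- s n) ∣
      ≤⟨ ℚP.+-mono-≤
           (product-bound (s m) (t m ℚ.- t n) 0<A (s≤A m K≤m)
             (t-close m n (ℕP.m⊔n≤o⇒n≤o M N M⊔N≤m) (ℕP.m⊔n≤o⇒n≤o M N M⊔N≤n)))
           (product-bound (t n) (s m ℚ.- s n) 0<B (t≤B n L≤n)
             (s-close m n (ℕP.m⊔n≤o⇒m≤o M N M⊔N≤m) (ℕP.m⊔n≤o⇒m≤o M N M⊔N≤n))) ⟩
    A ℚ.* δ ℚ.+ B ℚ.* δ
      ≡⟨ ℚP.*-distribʳ-+ δ A B ⟨
    (A ℚ.+ B) ℚ.* δ
      ≡⟨ [A+B]δ≡ε ⟩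
    ε ∎
  where open ℚP.≤-Reasoning

infixl 6 _+_
infixl 7 _*_

_+_ : ℝ → ℝ → ℝ
x + y = mkℝ (λ n → seq x n ℚ.+ seq y n) (+-cauchy {seq x} {seq y} (cauchy x) (cauchy y))

_*_ : ℝ → ℝ → ℝ
x * y = mkℝ (λ n → seq x n ℚ.* seq y n) (*-cauchy {seq x} {seq y} (cauchy x) (cauchy y))

∑ : ∀ {n} → (Fin n → ℝ) → ℝ
∑ = foldr _+_ 0ℝ

------------------------------------------------------------------------
-- Natural logarithm of a positive integer, log k = ∫₁ᵏ dt/t

∑< : ℕ → (ℕ → ℚ) → ℚ
∑< zero    f = 0ℚ
∑< (suc n) f = ∑< n f ℚ.+ f n

recip : (n : ℕ) → .{{ℕ.NonZero n}} → ℚ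
recip n = + 1 / n

-- The left-endpoint Riemann sum for ∫₁ᵏ dt/t over intervals of length 1/m, where m = suc n:
-- the sum over j < (k - 1) m of (1/m) · 1/(1 + j/m) = 1/(m + j).
riemann : ℕ → ℕ → ℚ
riemann k n = ∑< ((k ℕ.∸ 1) ℕ.* suc n) (λ j → recip (suc n ℕ.+ j))

module RiemannSums where
  -- The right-endpoint sum.
  riemannʳ : ℕ → ℕ → ℚ
  riemannʳ k n = ∑< ((k ℕ.∸ 1) ℕ.* suc n) (λ j → recip (suc (suc n ℕ.+ j)))

  toℚᵘ-/ : ∀ i n → ℚ.toℚᵘ (i / suc n) ℚᵘ.≃ ℚᵘ.mkℚᵘ i n
  toℚᵘ-/ i n = ℚP.toℚᵘ-fromℚᵘ (ℚᵘ.mkℚᵘ i n)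

  recip-antitone : ∀ m n .{{_ : ℕ.NonZero m}} .{{_ : ℕ.NonZero n}} → m ℕ.≤ n → recip n ℚ.≤ recip m
  recip-antitone (suc m) (suc n) m≤n = ℚP.toℚᵘ-cancel-≤
    (ℚᵘP.≤-respˡ-≃ (ℚᵘP.≃-sym (toℚᵘ-/ (+ 1) n))
      (ℚᵘP.≤-respʳ-≃ (ℚᵘP.≃-sym (toℚᵘ-/ (+ 1) m))
        (ℚᵘ.*≤* (ℤP.*-monoˡ-≤-nonNeg (+ 1) (ℤ.+≤+ m≤n)))))

  recip-nonNeg : ∀ n .{{_ : ℕ.NonZero n}} → 0ℚ ℚ.≤ recip n
  recip-nonNeg n = ℚP.nonNegative⁻¹ _ {{ℚP.normalize-nonNeg 1 n}}

  ∑<-mono : ∀ n {f g : ℕ → ℚ} → (∀ j → j ℕ.< n → f j ℚ.≤ g j) → ∑< n f ℚ.≤ ∑< n g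
  ∑<-mono zero    f≤g = ℚP.≤-refl
  ∑<-mono (suc n) f≤g = ℚP.+-mono-≤ (∑<-mono n λ j j<n → f≤g j (ℕP.m<n⇒m<1+n j<n)) (f≤g n ℕP.≤-refl)

  ∑<-cong : ∀ n {f g : ℕ → ℚ} → (∀ j → f j ≡ g j) → ∑< n f ≡ ∑< n g
  ∑<-cong zero    f≡g = refl
  ∑<-cong (suc n) f≡g = cong₂ ℚ._+_ (∑<-cong n f≡g) (f≡g n)

  ∑<-+ : ∀ m n (f : ℕ → ℚ) → ∑< (m ℕ.+ n) f ≡ ∑< m f ℚ.+ ∑< n (λ j → f (m ℕ.+ j))
  ∑<-+ m zero    f = trans (cong (λ l → ∑< l f) (ℕP.+-identityʳ m)) (sym (ℚP.+-identityʳ _))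
  ∑<-+ m (suc n) f = trans (cong (λ l → ∑< l f) (ℕP.+-suc m n))
    (trans (cong (ℚ._+ f (m ℕ.+ n)) (∑<-+ m n f)) (ℚP.+-assoc (∑< m f) _ _))

  ∑<-blocks : ∀ m n (f : ℕ → ℚ) → ∑< (m ℕ.* n) f ≡ ∑< m (λ j → ∑< n (λ i → f (j ℕ.* n ℕ.+ i)))
  ∑<-blocks zero    n f = refl
  ∑<-blocks (suc m) n f = trans (cong (λ l → ∑< l f) (ℕP.+-comm n (m ℕ.* n)))
    (trans (∑<-+ (m ℕ.* n) n f) (cong (ℚ._+ ∑< n (λ i → f (m ℕ.* n ℕ.+ i))) (∑<-blocks m n f)))

  ∑<-recip : ∀ n d → ∑< n (λ _ → recip (suc d)) ≡ + n / suc d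
  ∑<-recip zero    d = ℚP.toℚᵘ-injective (ℚᵘP.≃-sym (ℚᵘP.≃-trans (toℚᵘ-/ (+ 0) d) (ℚᵘ.*≡* refl)))
  ∑<-recip (suc n) d = trans (cong (ℚ._+ recip (suc d)) (∑<-recip n d))
    (ℚP.toℚᵘ-injective
      (ℚᵘP.≃-trans (ℚP.toℚᵘ-homo-+ (+ n / suc d) (recip (suc d)))
      (ℚᵘP.≃-trans (ℚᵘP.+-cong (toℚᵘ-/ (+ n) d) (toℚᵘ-/ (+ 1) d))
      (ℚᵘP.≃-trans (ℚᵘ.*≡* (arith (+ n) (+ suc d))) (ℚᵘP.≃-sym (toℚᵘ-/ (+ suc n) d))))))
    where
    arith : ∀ i j → (i ℤ.* j ℤ.+ + 1 ℤ.* j) ℤ.* j ≡ (+ 1 ℤ.+ i) ℤ.* (j ℤ.* j)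
    arith = ℤSolver.solve-∀

  -- n · 1/(a n) = 1/a
  ∑<-recip-* : ∀ n a → ∑< (suc n) (λ _ → recip (suc a ℕ.* suc n)) ≡ recip (suc a)
  ∑<-recip-* n a = trans (∑<-recip (suc n) (n ℕ.+ a ℕ.* suc n))
    (ℚP.toℚᵘ-injective
      (ℚᵘP.≃-trans (toℚᵘ-/ (+ suc n) (n ℕ.+ a ℕ.* suc n))
      (ℚᵘP.≃-trans (ℚᵘ.*≡* (cong +_ (arith n a))) (ℚᵘP.≃-sym (toℚᵘ-/ (+ 1) a)))))
    where
    arith : ∀ n a → suc n ℕ.* suc a ≡ 1 ℕ.* (suc a ℕ.* suc n)
    arith = ℕSolver.solve-∀

  refine : ℕ → ℕ → ℕ
  refine a b = b ℕ.+ a ℕ.* suc b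

  refine-comm : ∀ a b → refine a b ≡ refine b a
  refine-comm a b = ℕP.suc-injective (ℕP.*-comm (suc a) (suc b))

  ∑<-refine : ∀ k a b (f : ℕ → ℚ) →
    ∑< ((k ℕ.∸ 1) ℕ.* suc (refine a b)) f ≡
    ∑< ((k ℕ.∸ 1) ℕ.* suc a) (λ j → ∑< (suc b) (λ i → f (j ℕ.* suc b ℕ.+ i)))
  ∑<-refine k a b f = trans (cong (λ l → ∑< l f) (sym (ℕP.*-assoc (k ℕ.∸ 1) (suc a) (suc b))))
    (∑<-blocks ((k ℕ.∸ 1) ℕ.* suc a) (suc b) f)

  riemann-refine : ∀ k a b → riemann k (refine a b) ℚ.≤ riemann k a
  riemann-refine k a b = begin
    riemann k (refine a b)
      ≡⟨ ∑<-refine k a b (λ j → recip (suc (refine a b) ℕ.+ j)) ⟩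
    ∑< J (λ j → ∑< (suc b) (λ i → recip (suc (refine a b) ℕ.+ (j ℕ.* suc b ℕ.+ i))))
      ≤⟨ ∑<-mono J (λ j _ → ∑<-mono (suc b) (λ i _ →
           recip-antitone (suc (a ℕ.+ j) ℕ.* suc b) (suc (refine a b) ℕ.+ (j ℕ.* suc b ℕ.+ i)) (le j i))) ⟩
    ∑< J (λ j → ∑< (suc b) (λ _ → recip (suc (a ℕ.+ j) ℕ.* suc b)))
      ≡⟨ ∑<-cong J (λ j → ∑<-recip-* b (a ℕ.+ j)) ⟩
    riemann k a ∎
    where
    open ℚP.≤-Reasoning
    J = (k ℕ.∸ 1) ℕ.* suc a
    arith : ∀ m j n i → (m ℕ.+ j) ℕ.* n ℕ.+ i ≡ m ℕ.* n ℕ.+ (j ℕ.* n ℕ.+ i)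
    arith = ℕSolver.solve-∀
    le : ∀ j i → suc (a ℕ.+ j) ℕ.* suc b ℕ.≤ suc (refine a b) ℕ.+ (j ℕ.* suc b ℕ.+ i)
    le j i = subst (suc (a ℕ.+ j) ℕ.* suc b ℕ.≤_) (arith (suc a) j (suc b) i) (ℕP.m≤m+n _ i)

  riemannʳ-refine : ∀ k a b → riemannʳ k a ℚ.≤ riemannʳ k (refine a b)
  riemannʳ-refine k a b = begin
    riemannʳ k a
      ≡⟨ ∑<-cong J (λ j → ∑<-recip-* b (suc a ℕ.+ j)) ⟨
    ∑< J (λ j → ∑< (suc b) (λ _ → recip (suc (suc a ℕ.+ j) ℕ.* suc b)))
      ≤⟨ ∑<-mono J (λ j _ → ∑<-mono (suc b) (λ i i<n →
           recip-antitone (suc (suc (refine a b) ℕ.+ (j ℕ.* suc b ℕ.+ i))) (suc (suc a ℕ.+ j) ℕ.* suc b) (le j i i<n))) ⟩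
    ∑< J (λ j → ∑< (suc b) (λ i → recip (suc (suc (refine a b) ℕ.+ (j ℕ.* suc b ℕ.+ i)))))
      ≡⟨ ∑<-refine k a b (λ j → recip (suc (suc (refine a b) ℕ.+ j))) ⟨
    riemannʳ k (refine a b) ∎
    where
    open ℚP.≤-Reasoning
    J = (k ℕ.∸ 1) ℕ.* suc a
    arith : ∀ m j n i → suc i ℕ.+ (m ℕ.+ j) ℕ.* n ≡ suc (m ℕ.* n ℕ.+ (j ℕ.* n ℕ.+ i))
    arith = ℕSolver.solve-∀
    le : ∀ j i → i ℕ.< suc b → suc (suc (refine a b) ℕ.+ (j ℕ.* suc b ℕ.+ i)) ℕ.≤ suc (suc a ℕ.+ j) ℕ.* suc b
    le j i i<n = subst (ℕ._≤ suc (suc a ℕ.+ j) ℕ.* suc b) (arith (suc a) j (suc b) i)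
      (ℕP.+-monoˡ-≤ ((suc a ℕ.+ j) ℕ.* suc b) i<n)

  riemannʳ≤riemann : ∀ k a b → riemannʳ k a ℚ.≤ riemann k b
  riemannʳ≤riemann k a b = begin
    riemannʳ k a             ≤⟨ riemannʳ-refine k a b ⟩
    riemannʳ k (refine a b)  ≤⟨ ∑<-mono ((k ℕ.∸ 1) ℕ.* suc (refine a b)) (λ j _ →
                                 recip-antitone (suc (refine a b) ℕ.+ j) (suc (suc (refine a b) ℕ.+ j)) (ℕP.n≤1+n _)) ⟩
    riemann k (refine a b)   ≡⟨ cong (riemann k) (refine-comm a b) ⟩
    riemann k (refine b a)   ≤⟨ riemann-refine k b a ⟩
    riemann k b              ∎
    where open ℚP.≤-Reasoning

  shift : ∀ n a → ∑< n (λ j → recip (suc a ℕ.+ j)) ℚ.+ recip (suc a ℕ.+ n) ≡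
                  recip (suc a) ℚ.+ ∑< n (λ j → recip (suc (suc a ℕ.+ j)))
  shift zero    a = trans (ℚP.+-identityˡ _)
    (trans (cong (λ b → recip (suc b)) (ℕP.+-identityʳ a)) (sym (ℚP.+-identityʳ _)))
  shift (suc n) a = trans
    (cong₂ ℚ._+_ (shift n a) (cong (λ b → recip (suc b)) (ℕP.+-suc a n)))
    (ℚP.+-assoc (recip (suc a)) _ _)

  riemann-gap : ∀ k a → riemann k a ℚ.≤ recip (suc a) ℚ.+ riemannʳ k a
  riemann-gap k a = begin
    riemann k a                                ≡⟨ ℚP.+-identityʳ _ ⟨
    riemann k a ℚ.+ 0ℚ                         ≤⟨ ℚP.+-monoʳ-≤ (riemann k a) (recip-nonNeg (suc a ℕ.+ J)) ⟩
    riemann k a ℚ.+ recip (suc a ℕ.+ J)        ≡⟨ shift J a ⟩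
    recip (suc a) ℚ.+ riemannʳ k a             ∎
    where
    open ℚP.≤-Reasoning
    J = (k ℕ.∸ 1) ℕ.* suc a

  riemann-diff : ∀ k a b ε → recip (suc a) ℚ.≤ ε → riemann k a ℚ.- riemann k b ℚ.≤ ε
  riemann-diff k a b ε 1/a≤ε = begin
    riemann k a ℚ.- riemann k b                   ≤⟨ ℚP.+-monoˡ-≤ (ℚ.- riemann k b) (riemann-gap k a) ⟩
    recip (suc a) ℚ.+ riemannʳ k a ℚ.- riemann k b ≤⟨ ℚP.+-monoˡ-≤ (ℚ.- riemann k b)
                                                        (ℚP.+-mono-≤ 1/a≤ε (riemannʳ≤riemann k a b)) ⟩
    ε ℚ.+ riemann k b ℚ.- riemann k b             ≡⟨ cancel ε (riemann k b) ⟩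
    ε                                             ∎
    where
    open ℚP.≤-Reasoning
    open ℚSolver.+-*-Solver
    cancel : ∀ p q → p ℚ.+ q ℚ.- q ≡ p
    cancel = solve 2 (λ p q → p :+ q :- q := p) refl

  ∣-∣-≤ : ∀ p q {ε} → p ℚ.- q ℚ.≤ ε → q ℚ.- p ℚ.≤ ε → ∣ p ℚ.- q ∣ ℚ.≤ ε
  ∣-∣-≤ p q {ε} p-q≤ε q-p≤ε with ℚP.∣p∣≡p∨∣p∣≡-p (p ℚ.- q)
  ... | inj₁ eq = subst (ℚ._≤ ε) (sym eq) p-q≤ε
  ... | inj₂ eq = subst (ℚ._≤ ε) (sym (trans eq (flip p q))) q-p≤ε
    where
    open ℚSolver.+-*-Solver
    flip : ∀ p q → ℚ.- (p ℚ.- q) ≡ q ℚ.- p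
    flip = solve 2 (λ p q → :- (p :- q) := q :- p) refl

  archimedean : ∀ ε → 0ℚ ℚ.< ε → ∃[ N ] recip (suc N) ℚ.≤ ε
  archimedean ε@(mkℚ (+ suc p) d _) _ = d , ℚP.toℚᵘ-cancel-≤
    (ℚᵘP.≤-respˡ-≃ (ℚᵘP.≃-sym (toℚᵘ-/ (+ 1) d))
      (ℚᵘ.*≤* (ℤP.*-monoʳ-≤-nonNeg (+ suc d) (ℤ.+≤+ (s≤s (ℕ.z≤n {p}))))))
  archimedean (mkℚ (+ zero) d _) (ℚ.*<* (ℤ.+<+ ()))
  archimedean (mkℚ ℤ.-[1+ p ] d _) (ℚ.*<* ())

open RiemannSums

riemann-cauchy : ∀ k → IsCauchy (riemann k)
riemann-cauchy k ε 0<ε =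
  let N , 1/N≤ε = archimedean ε 0<ε
      small : ∀ n → N ℕ.≤ n → recip (suc n) ℚ.≤ ε
      small n N≤n = ℚP.≤-trans (recip-antitone (suc N) (suc n) (s≤s N≤n)) 1/N≤ε
  in N , λ m n N≤m N≤n → ∣-∣-≤ (riemann k m) (riemann k n)
       (riemann-diff k m n ε (small m N≤m)) (riemann-diff k n m ε (small n N≤n))

-- Meaningful for k ≥ 1; log 0 has the junk value 0.
log : ℕ → ℝ
log k = mkℝ (riemann k) (riemann-cauchy k)

------------------------------------------------------------------------
-- Tournaments; the vertex set [k] is Fin k

record Tournament (k : ℕ) : Set where
  field
    -- edge i j ≡ true means that the pair {i , j} is directed from i to j.
    edge        : Fin k → Fin k → Bool
    irreflexive : ∀ i → edge i i ≡ false
    oriented    : ∀ i j → i ≢ j → edge j i ≡ not (edge i j)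

open Tournament public

∑-edges : ∀ {k} → Tournament k → (Fin k → Fin k → ℝ) → ℝ
∑-edges R w = ∑ λ i → ∑ λ j → if edge R i j then w i j else 0ℝ

{-# OPTIONS --safe #-}
-- The tournament depends only on k. With r = 1 + 1/10000, give a pair (i , j) ∈ A × B the weight
-- r⁵⁰ if i → j and r⁻⁵¹ if j → i. Since r⁵⁰ + r⁻⁵¹ ≤ 2 (and r⁵⁰ r⁻⁵¹ ≤ 1, for edges inside A ∩ B),
-- the expected product of these weights in a random tournament is at most 1. Discounting each vertex
-- of A and B by a factor K = 4k, some tournament has Σ_{A,B} K^{-|A|-|B|} Π weight ≤ (1 + 1/K)²ᵏ ≤ 2.
-- Comparing exponents of r yields
--   101 e(A,B) ≤ 51 |A||B| + O(log k) (|A| + |B|) + O(1)   for all A, B ⊆ [k].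
-- The analogous inequality for weight functions f, g is affine in each f(i) and each g(j), hence it
-- follows on the whole cube from its validity at the vertices. Finally (Σ f)(Σ g) ≤ x², and the
-- error terms are below x²/200 because x is a large multiple of log k.
module Submission where

open import Algebra.Bundles using (module CommutativeRing)
import Algebra.Properties.Semiring.Sum as SemiringSum
open import Data.Bool.Base using (Bool; true; false; not; _∧_; if_then_else_)
open import Data.Bool.Properties using (if-float; not-involutive)
open import Data.Empty using (⊥-elim)
import Data.Nat.Base as ℕ
import Data.Nat.Properties as ℕP
import Data.Nat.Tactic.RingSolver as ℕSolver
open import Data.Product using (∃-syntax; _×_; _,_; proj₁; proj₂)
open import Data.Sum.Base using (inj₁; inj₂)
open import Data.Vec.Base using (Vec; []; _∷_; lookup)
open import Function.Base using (id)
open import Relation.Binary.PropositionalEquality using (_≡_; _≢_; refl; sym; trans; cong; cong₂; subst; subst₂; module ≡-Reasoning)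
open import Relation.Nullary using (yes; no; contradiction)

-- Orientations and the potential function

-- A union bound over all pairs (A , B) would cost an error of order k, useless when x is only a
-- multiple of log k. Discounting each chosen vertex makes the error proportional to log k times |A|
-- + |B|, hence to x log k for weight functions, which x² absorbs. This error is also affine in each
-- coordinate, so it survives the passage from sets to weight functions. Symmetric weights rᴺ and
-- r⁻ᴺ would have a sum above 2. Lowering the second exponent by one creates a first-order drop that
-- beats the second-order excess once r is close enough to 1. The price is the density 51/101 in
-- place of 1/2, still below 0.51. Tail estimate and union bound are thus merged into one sum of
-- products. It is a natural number once denominators are cleared, so averaging and choosing a
-- tournament take place in ℕ, without probabilities or real exponentials. On the real side the
-- order is not decidable, so arguments by the sign of a coefficient are replaced by explicit
-- nonnegative slacks.

module Counting where
  open import Data.Nat.Base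
  open import Data.Nat.Properties
  open import Data.Nat.Tactic.RingSolver using (solve-∀)

  ∑ᵛ : ∀ k → (Vec Bool k → ℕ) → ℕ
  ∑ᵛ zero    F = F []
  ∑ᵛ (suc k) F = ∑ᵛ k (λ v → F (true ∷ v)) + ∑ᵛ k (λ v → F (false ∷ v))

  ∑ᵛ-mono : ∀ k {F G} → (∀ v → F v ≤ G v) → ∑ᵛ k F ≤ ∑ᵛ k G
  ∑ᵛ-mono zero    F≤G = F≤G []
  ∑ᵛ-mono (suc k) F≤G = +-mono-≤ (∑ᵛ-mono k λ v → F≤G (true ∷ v)) (∑ᵛ-mono k λ v → F≤G (false ∷ v))

  ∑ᵛ-cong : ∀ k {F G} → (∀ v → F v ≡ G v) → ∑ᵛ k F ≡ ∑ᵛ k G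
  ∑ᵛ-cong zero    F≡G = F≡G []
  ∑ᵛ-cong (suc k) F≡G = cong₂ _+_ (∑ᵛ-cong k λ v → F≡G (true ∷ v)) (∑ᵛ-cong k λ v → F≡G (false ∷ v))

  ∑ᵛ-*ˡ : ∀ k c F → ∑ᵛ k (λ v → c * F v) ≡ c * ∑ᵛ k F
  ∑ᵛ-*ˡ zero    c F = refl
  ∑ᵛ-*ˡ (suc k) c F = trans (cong₂ _+_ (∑ᵛ-*ˡ k c _) (∑ᵛ-*ˡ k c _)) (sym (*-distribˡ-+ c _ _))

  ∑ᵛ-+ : ∀ k F G → ∑ᵛ k (λ v → F v + G v) ≡ ∑ᵛ k F + ∑ᵛ k G
  ∑ᵛ-+ zero    F G = refl
  ∑ᵛ-+ (suc k) F G = trans (cong₂ _+_ (∑ᵛ-+ k _ _) (∑ᵛ-+ k _ _)) (interchange (∑ᵛ k _) (∑ᵛ k _) _ _)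
    where
    interchange : ∀ a b c d → (a + b) + (c + d) ≡ (a + c) + (b + d)
    interchange = solve-∀

  ∑ᵛ-swap : ∀ k l (F : Vec Bool k → Vec Bool l → ℕ) →
    ∑ᵛ k (λ u → ∑ᵛ l (F u)) ≡ ∑ᵛ l (λ v → ∑ᵛ k (λ u → F u v))
  ∑ᵛ-swap zero    l F = refl
  ∑ᵛ-swap (suc k) l F = trans (cong₂ _+_ (∑ᵛ-swap k l _) (∑ᵛ-swap k l _)) (sym (∑ᵛ-+ l _ _))

  term≤∑ᵛ : ∀ {k} F v → F v ≤ ∑ᵛ k F
  term≤∑ᵛ F []          = ≤-refl
  term≤∑ᵛ F (true ∷ v)  = ≤-trans (term≤∑ᵛ (λ u → F (true ∷ u)) v) (m≤m+n _ _)
  term≤∑ᵛ F (false ∷ v) = ≤-trans (term≤∑ᵛ (λ u → F (false ∷ u)) v) (m≤n+m _ _)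

  -- Some value is at most the average. The bits are chosen one by one: if both halves exceeded
  -- `2 ^ k * c`, so would their total exceed twice that.
  ∑ᵛ-pigeonhole : ∀ k F c → ∑ᵛ k F ≤ 2 ^ k * c → ∃[ v ] F v ≤ c
  ∑ᵛ-pigeonhole zero    F c F≤c = [] , ≤-trans F≤c (≤-reflexive (*-identityˡ c))
  ∑ᵛ-pigeonhole (suc k) F c ∑F≤c with ∑ᵛ k (λ v → F (true ∷ v)) ≤? 2 ^ k * c
  ... | yes l≤c = let v , Fv≤c = ∑ᵛ-pigeonhole k _ c l≤c in true ∷ v , Fv≤c
  ... | no  l≰c with ∑ᵛ k (λ v → F (false ∷ v)) ≤? 2 ^ k * c
  ...   | yes r≤c = let v , Fv≤c = ∑ᵛ-pigeonhole k _ c r≤c in false ∷ v , Fv≤c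
  ...   | no  r≰c = ⊥-elim (<-irrefl refl (<-≤-trans (+-mono-< (≰⇒> l≰c) (≰⇒> r≰c)) (≤-trans ∑F≤c (≤-reflexive (double (2 ^ k) c)))))
    where
    double : ∀ a c → (2 * a) * c ≡ a * c + a * c
    double = solve-∀

  ⟦_⟧ : Bool → ℕ
  ⟦ b ⟧ = if b then 1 else 0

  size : ∀ {k} → Vec Bool k → ℕ
  size []      = 0
  size (b ∷ A) = ⟦ b ⟧ + size A

  infixr 5 _∷_

  -- In v ∷ t, the entries of v are the directions of the edges at the vertex 0, true for outgoing.
  data Orientation : ℕ → Set where
    []  : Orientation 0
    _∷_ : ∀ {k} → Vec Bool k → Orientation k → Orientation (suc k)

  rowCount : (Bool → Bool) → ∀ {k} → Vec Bool k → Bool → Bool → Vec Bool k → Vec Bool k → ℕ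
  rowCount σ []      a b []       []       = 0
  rowCount σ (x ∷ v) a b (a′ ∷ A) (b′ ∷ B) =
    (⟦ (a ∧ b′) ∧ σ x ⟧ + ⟦ (a′ ∧ b) ∧ σ (not x) ⟧) + rowCount σ v a b A B

  -- Counts the pairs (i , j) ∈ A × B, i ≠ j, for which σ holds of the truth value of i → j;
  -- rowCount is the contribution of the pairs involving the vertex 0.
  count : (Bool → Bool) → ∀ {k} → Orientation k → Vec Bool k → Vec Bool k → ℕ
  count σ []      []      []      = 0
  count σ (v ∷ t) (a ∷ A) (b ∷ B) = rowCount σ v a b A B + count σ t A B

  forward backward : ∀ {k} → Orientation k → Vec Bool k → Vec Bool k → ℕ
  forward  = count id
  backward = count not

  private
    cell : ∀ a b x → ⟦ (a ∧ b) ∧ x ⟧ + ⟦ (a ∧ b) ∧ not x ⟧ ≡ ⟦ a ⟧ * ⟦ b ⟧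
    cell true  true  true  = refl
    cell true  true  false = refl
    cell true  false x     = refl
    cell false b     x     = refl

    row-total : ∀ {k} (v : Vec Bool k) a b A B →
      rowCount id v a b A B + rowCount not v a b A B ≡ ⟦ a ⟧ * size B + size A * ⟦ b ⟧
    row-total []      a b []       []       = cong (_+ 0) (sym (*-zeroʳ ⟦ a ⟧))
    row-total (x ∷ v) a b (a′ ∷ A) (b′ ∷ B) = trans
      (regroup ⟦ (a ∧ b′) ∧ x ⟧ ⟦ (a ∧ b′) ∧ not x ⟧ ⟦ (a′ ∧ b) ∧ not x ⟧ ⟦ (a′ ∧ b) ∧ not (not x) ⟧ _ _)
      (trans (cong₂ _+_ (cong₂ _+_ (cell a b′ x) (cell a′ b (not x))) (row-total v a b A B))
        (expand ⟦ a ⟧ ⟦ b ⟧ ⟦ a′ ⟧ ⟦ b′ ⟧ (size A) (size B)))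
      where
      regroup : ∀ c d e f m n → ((c + e) + m) + ((d + f) + n) ≡ ((c + d) + (e + f)) + (m + n)
      regroup = solve-∀
      expand : ∀ a b a′ b′ m n → (a * b′ + a′ * b) + (a * n + m * b) ≡ a * (b′ + n) + (a′ + m) * b
      expand = solve-∀

    -- The two sides differ by |A ∩ B|: diagonal pairs lie in A × B but carry no edge. The term
    -- `⟦ a ⟧ * ⟦ b ⟧` added in the proof is the diagonal pair of vertex 0.
    total≤ : ∀ {k} (t : Orientation k) A B → forward t A B + backward t A B ≤ size A * size B
    total≤ []      []      []      = z≤n
    total≤ (v ∷ t) (a ∷ A) (b ∷ B) = begin
      (rowCount id v a b A B + forward t A B) + (rowCount not v a b A B + backward t A B)
        ≡⟨ interchange (rowCount id v a b A B) _ _ _ ⟩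
      (rowCount id v a b A B + rowCount not v a b A B) + (forward t A B + backward t A B)
        ≤⟨ +-mono-≤ (≤-reflexive (row-total v a b A B)) (total≤ t A B) ⟩
      (⟦ a ⟧ * size B + size A * ⟦ b ⟧) + size A * size B
        ≤⟨ m≤n+m _ (⟦ a ⟧ * ⟦ b ⟧) ⟩
      ⟦ a ⟧ * ⟦ b ⟧ + ((⟦ a ⟧ * size B + size A * ⟦ b ⟧) + size A * size B)
        ≡⟨ expand ⟦ a ⟧ ⟦ b ⟧ (size A) (size B) ⟩
      (⟦ a ⟧ + size A) * (⟦ b ⟧ + size B) ∎
      where
      open ≤-Reasoning
      interchange : ∀ a b c d → (a + b) + (c + d) ≡ (a + c) + (b + d)
      interchange = solve-∀
      expand : ∀ a b m n → a * b + ((a * n + m * b) + m * n) ≡ (a + m) * (b + n)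
      expand = solve-∀

  -- All weights are kept in ℕ: every ordered pair carries an extra factor D, and every vertex an
  -- extra factor K in each of A and B.
  module Potential (K p q D : ℕ) (p+q≤2D : p + q ≤ 2 * D) (pq≤D² : p * q ≤ D * D) where

    w : Bool → Bool → ℕ
    w c x = if c then (if x then p else q) else D

    row : ∀ {k} → Vec Bool k → Bool → Bool → Vec Bool k → Vec Bool k → ℕ
    row []      a b []       []       = 1
    row (x ∷ v) a b (a′ ∷ A) (b′ ∷ B) = (w (a ∧ b′) x * w (a′ ∧ b) (not x)) * row v a b A B

    κ : Bool → ℕ
    κ b = if b then 1 else K

    weight : ∀ {k} → Orientation k → Vec Bool k → Vec Bool k → ℕ
    weight []      []      []      = 1
    weight (v ∷ t) (a ∷ A) (b ∷ B) = κ a * (κ b * (weight t A B * row v a b A B))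

    -- One number that controls all pairs at once, since each weight is at most the whole sum.
    Φ : ∀ {k} → Orientation k → ℕ
    Φ {k} t = ∑ᵛ k λ A → ∑ᵛ k λ B → weight t A B

    -- Here `c` and `d` tell whether (0 , i) and (i , 0) lie in A × B. Both pairs read the same
    -- edge, so they must be averaged together. If just one counts, the two directions give p and q;
    -- if both count, either direction gives p q.
    cell-average : ∀ c d → w c true * w d false + w c false * w d true ≤ 2 * (D * D)
    cell-average true true = begin
      p * q + q * p  ≡⟨ eq p q ⟩
      2 * (p * q)    ≤⟨ *-monoʳ-≤ 2 pq≤D² ⟩
      2 * (D * D)    ∎
      where
      open ≤-Reasoning
      eq : ∀ p q → p * q + q * p ≡ 2 * (p * q)
      eq = solve-∀
    cell-average true false = begin
      p * D + q * D  ≡⟨ *-distribʳ-+ D p q ⟨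
      (p + q) * D    ≤⟨ *-monoˡ-≤ D p+q≤2D ⟩
      2 * D * D      ≡⟨ *-assoc 2 D D ⟩
      2 * (D * D)    ∎
      where open ≤-Reasoning
    cell-average false true = begin
      D * q + D * p  ≡⟨ eq D p q ⟩
      (p + q) * D    ≤⟨ *-monoˡ-≤ D p+q≤2D ⟩
      2 * D * D      ≡⟨ *-assoc 2 D D ⟩
      2 * (D * D)    ∎
      where
      open ≤-Reasoning
      eq : ∀ D p q → D * q + D * p ≡ (p + q) * D
      eq = solve-∀
    cell-average false false = ≤-reflexive (cong (D * D +_) (sym (+-identityʳ (D * D))))

    -- The edges at vertex 0 are chosen independently, so the average of the product is the product
    -- of the averages.
    row-average : ∀ {k} a b (A B : Vec Bool k) → ∑ᵛ k (λ v → row v a b A B) ≤ 2 ^ k * (D * D) ^ k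
    row-average a b [] [] = ≤-refl
    row-average {suc k} a b (a′ ∷ A) (b′ ∷ B) = begin
      ∑ᵛ k (λ v → (w (a ∧ b′) true * w (a′ ∧ b) false) * row v a b A B)
        + ∑ᵛ k (λ v → (w (a ∧ b′) false * w (a′ ∧ b) true) * row v a b A B)
        ≡⟨ cong₂ _+_ (∑ᵛ-*ˡ k (w (a ∧ b′) true * w (a′ ∧ b) false) (λ v → row v a b A B))
                     (∑ᵛ-*ˡ k (w (a ∧ b′) false * w (a′ ∧ b) true) (λ v → row v a b A B)) ⟩
      (w (a ∧ b′) true * w (a′ ∧ b) false) * R + (w (a ∧ b′) false * w (a′ ∧ b) true) * R
        ≡⟨ *-distribʳ-+ R (w (a ∧ b′) true * w (a′ ∧ b) false) _ ⟨
      (w (a ∧ b′) true * w (a′ ∧ b) false + w (a ∧ b′) false * w (a′ ∧ b) true) * R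
        ≤⟨ *-mono-≤ (cell-average (a ∧ b′) (a′ ∧ b)) (row-average a b A B) ⟩
      2 * (D * D) * (2 ^ k * (D * D) ^ k)
        ≡⟨ eq (D * D) (2 ^ k) ((D * D) ^ k) ⟩
      2 ^ suc k * (D * D) ^ suc k ∎
      where
      open ≤-Reasoning
      R = ∑ᵛ k (λ v → row v a b A B)
      eq : ∀ d m n → 2 * d * (m * n) ≡ 2 * m * (d * n)
      eq = solve-∀

    Φ-average : ∀ {k} (t : Orientation k) →
      ∑ᵛ k (λ v → Φ (v ∷ t)) ≤ 2 ^ k * ((1 + K) * (1 + K) * (D * D) ^ k * Φ t)
    Φ-average {k} t = begin
      ∑ᵛ k (λ v → Φ (v ∷ t))
        ≡⟨ ∑ᵛ-swap k (suc k) (λ v A → ∑ᵛ (suc k) (λ B → weight (v ∷ t) A B)) ⟩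
      ∑ᵛ (suc k) (λ A → ∑ᵛ k λ v → ∑ᵛ (suc k) λ B → weight (v ∷ t) A B)
        ≡⟨ ∑ᵛ-cong (suc k) (λ A → ∑ᵛ-swap k (suc k) (λ v B → weight (v ∷ t) A B)) ⟩
      ∑ᵛ (suc k) (λ A → ∑ᵛ (suc k) λ B → ∑ᵛ k λ v → weight (v ∷ t) A B)
        ≤⟨ ∑ᵛ-mono (suc k) (λ A → ∑ᵛ-mono (suc k) (λ B → average A B)) ⟩
      ∑ᵛ (suc k) (λ A → ∑ᵛ (suc k) λ B → majorant A B)
        -- The majorant depends on the head bits only through `κ`, so summing out each of them gives
        -- a factor `1 + K`.
        ≡⟨ head-sum (λ A → ∑ᵛ (suc k) (majorant A)) (λ A → (1 + K) * ∑ᵛ k (λ B → weight t A B * c))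
             (λ A → head-sum (majorant (true ∷ A)) (λ B → weight t A B * c) (λ B → trans (*-identityˡ _) (*-identityˡ _)) (λ B → *-identityˡ _))
             (λ A → trans (head-sum (majorant (false ∷ A)) (λ B → K * (weight t A B * c)) (λ B → cong (K *_) (*-identityˡ _)) (λ B → refl))
                      (trans (cong ((1 + K) *_) (∑ᵛ-*ˡ k K _)) (x∙yz≡y∙xz (1 + K) K _))) ⟩
      (1 + K) * ∑ᵛ k (λ A → (1 + K) * ∑ᵛ k (λ B → weight t A B * c))
        ≡⟨ cong ((1 + K) *_) (∑ᵛ-*ˡ k (1 + K) _) ⟩
      (1 + K) * ((1 + K) * ∑ᵛ k (λ A → ∑ᵛ k (λ B → weight t A B * c)))
        ≡⟨ cong (λ s → (1 + K) * ((1 + K) * s)) (trans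
             (∑ᵛ-cong k (λ A → trans (∑ᵛ-cong k (λ B → *-comm (weight t A B) c)) (∑ᵛ-*ˡ k c _)))
             (∑ᵛ-*ˡ k c _)) ⟩
      (1 + K) * ((1 + K) * (c * Φ t))
        ≡⟨ eq (1 + K) (2 ^ k) ((D * D) ^ k) (Φ t) ⟩
      2 ^ k * ((1 + K) * (1 + K) * (D * D) ^ k * Φ t) ∎
      where
      open ≤-Reasoning
      c = 2 ^ k * (D * D) ^ k
      majorant : Vec Bool (suc k) → Vec Bool (suc k) → ℕ
      majorant (a ∷ A) (b ∷ B) = κ a * (κ b * (weight t A B * c))
      average : ∀ A B → ∑ᵛ k (λ v → weight (v ∷ t) A B) ≤ majorant A B
      average (a ∷ A) (b ∷ B) = begin
        ∑ᵛ k (λ v → κ a * (κ b * (weight t A B * row v a b A B)))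
          ≡⟨ trans (∑ᵛ-*ˡ k (κ a) _) (cong (κ a *_) (trans (∑ᵛ-*ˡ k (κ b) _) (cong (κ b *_) (∑ᵛ-*ˡ k (weight t A B) _)))) ⟩
        κ a * (κ b * (weight t A B * ∑ᵛ k (λ v → row v a b A B)))
          ≤⟨ *-monoʳ-≤ (κ a) (*-monoʳ-≤ (κ b) (*-monoʳ-≤ (weight t A B) (row-average a b A B))) ⟩
        majorant (a ∷ A) (b ∷ B) ∎
      head-sum : ∀ (F : Vec Bool (suc k) → ℕ) G → (∀ A → F (true ∷ A) ≡ G A) → (∀ A → F (false ∷ A) ≡ K * G A) →
        ∑ᵛ (suc k) F ≡ (1 + K) * ∑ᵛ k G
      head-sum F G F₁ F₀ = cong₂ _+_ (∑ᵛ-cong k F₁) (trans (∑ᵛ-cong k F₀) (∑ᵛ-*ˡ k K G))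
      x∙yz≡y∙xz : ∀ a b x → a * (b * x) ≡ b * (a * x)
      x∙yz≡y∙xz = solve-∀
      eq : ∀ a m n x → a * (a * (m * n * x)) ≡ m * (a * a * n * x)
      eq = solve-∀

    -- D to the power k (k - 1), the common denominator of all ordered pairs: a new vertex forms two
    -- with each of the k old ones.
    cells : ℕ → ℕ
    cells zero    = 1
    cells (suc k) = (D * D) ^ k * cells k

    -- Conditional expectations, one vertex at a time: `Φ-average` bounds the mean over the edges at
    -- the new vertex, and `∑ᵛ-pigeonhole` picks a choice that does no worse.
    lightOrientation : ∀ k → ∃[ t ] Φ {k} t ≤ ((1 + K) * (1 + K)) ^ k * cells k
    lightOrientation zero    = [] , ≤-refl
    lightOrientation (suc k) =
      let t , Φt≤ = lightOrientation k
          v , Φvt≤ = ∑ᵛ-pigeonhole k (λ v → Φ (v ∷ t)) _ (Φ-average t)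
      in v ∷ t , (begin
        Φ (v ∷ t)                                                        ≤⟨ Φvt≤ ⟩
        (1 + K) * (1 + K) * (D * D) ^ k * Φ t                            ≤⟨ *-monoʳ-≤ ((1 + K) * (1 + K) * (D * D) ^ k) Φt≤ ⟩
        (1 + K) * (1 + K) * (D * D) ^ k * (((1 + K) * (1 + K)) ^ k * cells k)
          ≡⟨ eq ((1 + K) * (1 + K)) ((D * D) ^ k) (((1 + K) * (1 + K)) ^ k) (cells k) ⟩
        ((1 + K) * (1 + K)) ^ suc k * cells (suc k)                      ∎)
      where
      open ≤-Reasoning
      eq : ∀ a b c d → a * b * (c * d) ≡ a * c * (b * d)
      eq = solve-∀

    cell-weight : ∀ c x → w c x * D ^ (⟦ c ∧ x ⟧ + ⟦ c ∧ not x ⟧) ≡ p ^ ⟦ c ∧ x ⟧ * q ^ ⟦ c ∧ not x ⟧ * D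
    cell-weight false x     = trans (*-identityʳ D) (sym (*-identityˡ D))
    cell-weight true  true  = eq p D
      where
      eq : ∀ p D → p * (D * 1) ≡ p * 1 * 1 * D
      eq = solve-∀
    cell-weight true  false = eq q D
      where
      eq : ∀ p D → p * (D * 1) ≡ 1 * (p * 1) * D
      eq = solve-∀

    row-weight : ∀ {k} (v : Vec Bool k) a b A B →
      row v a b A B * D ^ (rowCount id v a b A B + rowCount not v a b A B) ≡
      p ^ rowCount id v a b A B * q ^ rowCount not v a b A B * (D * D) ^ k
    row-weight [] a b [] [] = refl
    row-weight {suc k} (x ∷ v) a b (a′ ∷ A) (b′ ∷ B) = begin
      (w c x * w d (not x)) * r * D ^ (((c₁ + d₁) + m) + ((c₀ + d₀) + n))
        ≡⟨ cong ((w c x * w d (not x)) * r *_) (trans (cong (D ^_) (regroup c₁ c₀ d₁ d₀ m n))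
             (trans (^-distribˡ-+-* D ((c₁ + c₀) + (d₁ + d₀)) (m + n)) (cong (_* D ^ (m + n)) (^-distribˡ-+-* D (c₁ + c₀) (d₁ + d₀))))) ⟩
      (w c x * w d (not x)) * r * ((D ^ (c₁ + c₀) * D ^ (d₁ + d₀)) * D ^ (m + n))
        ≡⟨ shuffle (w c x) (w d (not x)) r (D ^ (c₁ + c₀)) (D ^ (d₁ + d₀)) (D ^ (m + n)) ⟩
      (w c x * D ^ (c₁ + c₀)) * (w d (not x) * D ^ (d₁ + d₀)) * (r * D ^ (m + n))
        ≡⟨ cong₂ _*_ (cong₂ _*_ (cell-weight c x) (cell-weight d (not x))) (row-weight v a b A B) ⟩
      (p ^ c₁ * q ^ c₀ * D) * (p ^ d₁ * q ^ d₀ * D) * (p ^ m * q ^ n * (D * D) ^ k)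
        ≡⟨ collect (p ^ c₁) (q ^ c₀) (p ^ d₁) (q ^ d₀) (p ^ m) (q ^ n) D ((D * D) ^ k) ⟩
      ((p ^ c₁ * p ^ d₁) * p ^ m) * ((q ^ c₀ * q ^ d₀) * q ^ n) * (D * D * (D * D) ^ k)
        ≡⟨ cong (_* (D * D * (D * D) ^ k)) (cong₂ _*_ (join p c₁ d₁ m) (join q c₀ d₀ n)) ⟨
      p ^ ((c₁ + d₁) + m) * q ^ ((c₀ + d₀) + n) * (D * D * (D * D) ^ k) ∎
      where
      open ≡-Reasoning
      c = a ∧ b′
      d = a′ ∧ b
      r = row v a b A B
      c₁ = ⟦ c ∧ x ⟧
      c₀ = ⟦ c ∧ not x ⟧
      d₁ = ⟦ d ∧ not x ⟧
      d₀ = ⟦ d ∧ not (not x) ⟧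
      m = rowCount id v a b A B
      n = rowCount not v a b A B
      regroup : ∀ c d e f m n → ((c + e) + m) + ((d + f) + n) ≡ ((c + d) + (e + f)) + (m + n)
      regroup = solve-∀
      shuffle : ∀ a b c d e f → (a * b) * c * ((d * e) * f) ≡ (a * d) * (b * e) * (c * f)
      shuffle = solve-∀
      collect : ∀ a b c d e f D g → (a * b * D) * (c * d * D) * (e * f * g) ≡ ((a * c) * e) * ((b * d) * f) * (D * D * g)
      collect = solve-∀
      join : ∀ p a b c → p ^ ((a + b) + c) ≡ (p ^ a * p ^ b) * p ^ c
      join p a b c = trans (^-distribˡ-+-* p (a + b) c) (cong (_* p ^ c) (^-distribˡ-+-* p a b))

    κ-weight : ∀ a → κ a * K ^ ⟦ a ⟧ ≡ K
    κ-weight true  = trans (*-identityˡ (K * 1)) (*-identityʳ K)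
    κ-weight false = *-identityʳ K

    -- With e forward and f backward pairs, the weight is pᵉ qᶠ times D to the power k (k - 1) - e -
    -- f times K to the power 2 k - |A| - |B|. The negative exponents are moved to the left, which
    -- avoids truncated subtraction.
    weight-formula : ∀ {k} (t : Orientation k) A B →
      weight t A B * K ^ (size A + size B) * D ^ (forward t A B + backward t A B) ≡
      p ^ forward t A B * q ^ backward t A B * ((K * K) ^ k * cells k)
    weight-formula [] [] [] = refl
    weight-formula {suc k} (v ∷ t) (a ∷ A) (b ∷ B) = begin
      κ a * (κ b * (W * r)) * K ^ ((⟦ a ⟧ + |A|) + (⟦ b ⟧ + |B|)) * D ^ ((m + e) + (n + f))
        ≡⟨ cong₂ (λ x y → κ a * (κ b * (W * r)) * x * y) (split K ⟦ a ⟧ |A| ⟦ b ⟧ |B|) (split D m e n f) ⟩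
      κ a * (κ b * (W * r)) * ((K ^ ⟦ a ⟧ * K ^ ⟦ b ⟧) * K ^ (|A| + |B|)) * ((D ^ m * D ^ n) * D ^ (e + f))
        ≡⟨ cong (λ x → κ a * (κ b * (W * r)) * ((K ^ ⟦ a ⟧ * K ^ ⟦ b ⟧) * K ^ (|A| + |B|)) * (x * D ^ (e + f))) (^-distribˡ-+-* D m n) ⟨
      κ a * (κ b * (W * r)) * ((K ^ ⟦ a ⟧ * K ^ ⟦ b ⟧) * K ^ (|A| + |B|)) * (D ^ (m + n) * D ^ (e + f))
        ≡⟨ shuffle (κ a) (κ b) W r (K ^ ⟦ a ⟧) (K ^ ⟦ b ⟧) (K ^ (|A| + |B|)) (D ^ (m + n)) (D ^ (e + f)) ⟩
      (κ a * K ^ ⟦ a ⟧) * (κ b * K ^ ⟦ b ⟧) * (r * D ^ (m + n)) * (W * K ^ (|A| + |B|) * D ^ (e + f))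
        ≡⟨ cong₂ _*_ (cong₂ _*_ (cong₂ _*_ (κ-weight a) (κ-weight b)) (row-weight v a b A B)) (weight-formula t A B) ⟩
      K * K * (p ^ m * q ^ n * (D * D) ^ k) * (p ^ e * q ^ f * ((K * K) ^ k * cells k))
        ≡⟨ collect (K * K) (p ^ m) (q ^ n) ((D * D) ^ k) (p ^ e) (q ^ f) ((K * K) ^ k) (cells k) ⟩
      (p ^ m * p ^ e) * (q ^ n * q ^ f) * ((K * K) ^ suc k * cells (suc k))
        ≡⟨ cong₂ (λ x y → x * y * ((K * K) ^ suc k * cells (suc k))) (^-distribˡ-+-* p m e) (^-distribˡ-+-* q n f) ⟨
      p ^ (m + e) * q ^ (n + f) * ((K * K) ^ suc k * cells (suc k)) ∎
      where
      open ≡-Reasoning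
      W = weight t A B
      r = row v a b A B
      |A| = size A
      |B| = size B
      m = rowCount id v a b A B
      n = rowCount not v a b A B
      e = forward t A B
      f = backward t A B
      regroup : ∀ a b c d → (a + b) + (c + d) ≡ (a + c) + (b + d)
      regroup = solve-∀
      split : ∀ X a b c d → X ^ ((a + b) + (c + d)) ≡ (X ^ a * X ^ c) * X ^ (b + d)
      split X a b c d = trans (cong (X ^_) (regroup a b c d))
        (trans (^-distribˡ-+-* X (a + c) (b + d)) (cong (_* X ^ (b + d)) (^-distribˡ-+-* X a c)))
      shuffle : ∀ a b W r c d x y z → a * (b * (W * r)) * ((c * d) * x) * (y * z) ≡ (a * c) * (b * d) * (r * y) * (W * x * z)
      shuffle = solve-∀
      collect : ∀ KK a b g c d h i → KK * (a * b * g) * (c * d * (h * i)) ≡ (a * c) * (b * d) * (KK * h * (g * i))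
      collect = solve-∀

    light⇒balanced : ∀ {k} (t : Orientation k) → NonZero D → Φ t ≤ ((1 + K) * (1 + K)) ^ k * cells k → ∀ A B →
      p ^ forward t A B * q ^ backward t A B * (K * K) ^ k ≤
      ((1 + K) * (1 + K)) ^ k * K ^ (size A + size B) * D ^ (forward t A B + backward t A B)
    light⇒balanced {k} t D≢0 Φ≤ A B = *-cancelʳ-≤ _ _ (cells k) {{cells≢0 k}} (begin
      p ^ e * q ^ f * (K * K) ^ k * cells k
        ≡⟨ *-assoc (p ^ e * q ^ f) _ _ ⟩
      p ^ e * q ^ f * ((K * K) ^ k * cells k)
        ≡⟨ weight-formula t A B ⟨
      weight t A B * x * y
        ≤⟨ *-monoˡ-≤ y (*-monoˡ-≤ x (≤-trans (term≤∑ᵛ (weight t A) B) (≤-trans (term≤∑ᵛ (λ A → ∑ᵛ k (weight t A)) A) Φ≤))) ⟩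
      ((1 + K) * (1 + K)) ^ k * cells k * x * y
        ≡⟨ shuffle (((1 + K) * (1 + K)) ^ k) (cells k) x y ⟩
      ((1 + K) * (1 + K)) ^ k * x * y * cells k ∎)
      where
      open ≤-Reasoning
      e = forward t A B
      f = backward t A B
      x = K ^ (size A + size B)
      y = D ^ (e + f)
      instance _ = D≢0
      cells≢0 : ∀ k → NonZero (cells k)
      cells≢0 zero    = _
      cells≢0 (suc k) = m*n≢0 ((D * D) ^ k) (cells k) {{m^n≢0 (D * D) k {{m*n≢0 D D}}}} {{cells≢0 k}}
      shuffle : ∀ a b c d → a * b * c * d ≡ a * c * d * b
      shuffle = solve-∀

  -- Elementary estimates for powers

  -- (1 + 1/n)ʲ ≤ n / (n - j), where n = j + d.
  compound-interest : ∀ j d → (1 + (j + d)) ^ j * d ≤ (j + d) ^ j * (j + d)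
  compound-interest zero    d = ≤-refl
  compound-interest (suc j) d = begin
    (1 + n) * (1 + n) ^ j * d    ≡⟨ front (1 + n) ((1 + n) ^ j) d ⟩
    (1 + n) ^ j * ((1 + n) * d)  ≤⟨ *-monoʳ-≤ ((1 + n) ^ j) step ⟩
    (1 + n) ^ j * (n * suc d)    ≡⟨ middle ((1 + n) ^ j) n (suc d) ⟩
    -- The induction keeps n = j + d fixed; one factor (1 + n) / n has been paid for by raising d to
    -- d + 1.
    n * ((1 + n) ^ j * suc d)    ≤⟨ *-monoʳ-≤ n (subst (λ m → (1 + m) ^ j * suc d ≤ m ^ j * m) (+-suc j d) (compound-interest j (suc d))) ⟩
    n * (n ^ j * n)              ≡⟨ *-assoc n (n ^ j) n ⟨
    n * n ^ j * n                ∎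
    where
    open ≤-Reasoning
    n = suc j + d
    front : ∀ a b c → a * b * c ≡ b * (a * c)
    front = solve-∀
    middle : ∀ a b c → a * (b * c) ≡ b * (a * c)
    middle = solve-∀
    step : (1 + n) * d ≤ n * suc d
    step = begin
      d + n * d  ≤⟨ +-monoˡ-≤ (n * d) (m≤n+m d (suc j)) ⟩
      n + n * d  ≡⟨ *-suc n d ⟨
      n * suc d  ∎

  ^-distribʳ-* : ∀ n a b → (a * b) ^ n ≡ a ^ n * b ^ n
  ^-distribʳ-* zero    a b = refl
  ^-distribʳ-* (suc n) a b = trans (cong (a * b *_) (^-distribʳ-* n a b)) (interchange a b (a ^ n) (b ^ n))
    where
    interchange : ∀ a b c d → (a * b) * (c * d) ≡ (a * c) * (b * d)
    interchange = solve-∀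

  -- This is 1 + n / Q ≤ (1 + 1 / Q)ⁿ with denominators cleared.
  bernoulli : ∀ Q n → Q ^ n * (Q + n) ≤ Q * suc Q ^ n
  bernoulli Q zero    = ≤-reflexive (eq Q)
    where
    eq : ∀ Q → 1 * (Q + 0) ≡ Q * 1
    eq = solve-∀
  bernoulli Q (suc n) = begin
    Q * Q ^ n * (Q + suc n)                ≤⟨ m≤m+n _ (Q ^ n * n) ⟩
    Q * Q ^ n * (Q + suc n) + Q ^ n * n    ≡⟨ eq Q (Q ^ n) n ⟩
    suc Q * (Q ^ n * (Q + n))              ≤⟨ *-monoʳ-≤ (suc Q) (bernoulli Q n) ⟩
    suc Q * (Q * suc Q ^ n)                ≡⟨ swap (suc Q) Q (suc Q ^ n) ⟩
    Q * (suc Q * suc Q ^ n)                ∎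
    where
    open ≤-Reasoning
    eq : ∀ Q x n → Q * x * (Q + (1 + n)) + x * n ≡ (1 + Q) * (x * (Q + n))
    eq = solve-∀
    swap : ∀ a b c → a * (b * c) ≡ b * (a * c)
    swap = solve-∀

  2Q^Q≤[1+Q]^Q : ∀ Q .{{_ : NonZero Q}} → 2 * Q ^ Q ≤ suc Q ^ Q
  2Q^Q≤[1+Q]^Q Q = *-cancelˡ-≤ Q (≤-trans (≤-reflexive (eq Q (Q ^ Q))) (bernoulli Q Q))
    where
    eq : ∀ Q x → Q * (2 * x) ≡ x * (Q + Q)
    eq = solve-∀

  -- A logarithm to base r = 1 + 1 / Q: since the Q-th power of r is at least 2, a factor of 2 costs
  -- at most Q in the exponent of r.
  exponent< : ∀ Q .{{_ : NonZero Q}} s t → suc Q ^ t ≤ 2 ^ s * Q ^ t → t < Q * suc s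
  exponent< Q s t P^t≤ with Q * suc s ≤? t
  ... | no  Q[1+s]≰t = ≰⇒> Q[1+s]≰t
  ... | yes Q[1+s]≤t = contradiction P^t≤ (<⇒≱ (begin-strict
    2 ^ s * Q ^ t                        <⟨ *-monoˡ-< (Q ^ t) {{m^n≢0 Q t}} (^-monoʳ-< 2 ≤-refl (n<1+n s)) ⟩
    2 ^ suc s * Q ^ t                    ≡⟨ cong (2 ^ suc s *_) (power Q) ⟩
    2 ^ suc s * ((Q ^ Q) ^ suc s * Q ^ u) ≡⟨ *-assoc (2 ^ suc s) _ _ ⟨
    2 ^ suc s * (Q ^ Q) ^ suc s * Q ^ u  ≡⟨ cong (_* Q ^ u) (^-distribʳ-* (suc s) 2 (Q ^ Q)) ⟨
    (2 * Q ^ Q) ^ suc s * Q ^ u          ≤⟨ *-mono-≤ (^-monoˡ-≤ (suc s) (2Q^Q≤[1+Q]^Q Q)) (^-monoˡ-≤ u (n≤1+n Q)) ⟩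
    (suc Q ^ Q) ^ suc s * suc Q ^ u      ≡⟨ power (suc Q) ⟨
    suc Q ^ t                            ∎))
    where
    open ≤-Reasoning
    u = t ∸ Q * suc s
    power : ∀ X → X ^ t ≡ (X ^ Q) ^ suc s * X ^ u
    power X = trans (cong (X ^_) (sym (m+[n∸m]≡n Q[1+s]≤t)))
      (trans (^-distribˡ-+-* X (Q * suc s) u) (cong (_* X ^ u) (sym (^-*-assoc X Q (suc s)))))

  -- With r = 1 + 1/Q, the weights of the two directions are p / D = rᴺ and q / D = r⁻⁽ᴺ⁺¹⁾.
  module Orientations (Q N : ℕ) (Q≢0 : NonZero Q)
    (p+q≤2D : suc Q ^ (suc N + N) + Q ^ (suc N + N) ≤ 2 * (suc Q ^ suc N * Q ^ N)) where

    instance _ = Q≢0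

    P p q D : ℕ
    P = suc Q
    p = P ^ (suc N + N)
    q = Q ^ (suc N + N)
    D = P ^ suc N * Q ^ N

    -- The quotient of the two sides is r⁻¹, because the exponents N and -(N + 1) add up to -1.
    pq≤D² : p * q ≤ D * D
    pq≤D² = begin
      P ^ (suc N + N) * Q ^ (suc N + N)             ≡⟨ cong₂ _*_ (^-distribˡ-+-* P (suc N) N) (^-distribˡ-+-* Q (suc N) N) ⟩
      (P ^ suc N * P ^ N) * ((Q * Q ^ N) * Q ^ N)   ≡⟨ pull (P ^ suc N * P ^ N) Q (Q ^ N) ⟩
      Q * ((P ^ suc N * P ^ N) * (Q ^ N * Q ^ N))   ≤⟨ *-monoˡ-≤ _ (n≤1+n Q) ⟩
      P * ((P ^ suc N * P ^ N) * (Q ^ N * Q ^ N))   ≡⟨ push P (P ^ suc N) (P ^ N) (Q ^ N) ⟩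
      D * D                                         ∎
      where
      open ≤-Reasoning
      pull : ∀ a b c → a * ((b * c) * c) ≡ b * (a * (c * c))
      pull = solve-∀
      push : ∀ a b c d → a * ((b * c) * (d * d)) ≡ (b * d) * ((a * c) * d)
      push = solve-∀

    -- After division by the power of D, the hypothesis bounds r to the power N e - (N + 1) f by 2ˢ.
    -- A negative exponent satisfies the claim outright; otherwise it is `t`, and cancelling the
    -- common factor `X` leads to `exponent<`.
    exponents : ∀ s e f → p ^ e * q ^ f ≤ 2 ^ s * D ^ (e + f) → N * e ≤ suc N * f + Q * suc s
    exponents s e f bound with suc N * f ≤? N * e
    ... | no  above = ≤-trans (<⇒≤ (≰⇒> above)) (m≤m+n _ _)
    ... | yes below = begin
      N * e                       ≡⟨ Ne≡ ⟩
      suc N * f + t               ≤⟨ +-monoʳ-≤ (suc N * f) (<⇒≤ (exponent< Q s t P^t≤)) ⟩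
      suc N * f + Q * suc s       ∎
      where
      open ≤-Reasoning
      t = N * e ∸ suc N * f
      Ne≡ : N * e ≡ suc N * f + t
      Ne≡ = sym (m+[n∸m]≡n below)
      X = P ^ (suc N * (e + f)) * Q ^ ((suc N + N) * f)
      expand₁ : ∀ N e → (1 + N + N) * e ≡ (1 + N) * e + N * e
      expand₁ = solve-∀
      expand₂ : ∀ N e f t → (1 + N) * e + ((1 + N) * f + t) ≡ (1 + N) * (e + f) + t
      expand₂ = solve-∀
      expand₃ : ∀ N f t → (1 + N) * f + t + N * f ≡ (1 + N + N) * f + t
      expand₃ = solve-∀
      shuffle₁ : ∀ a b c → a * (b * c) ≡ (b * a) * c
      shuffle₁ = solve-∀
      shuffle₂ : ∀ a b c d → a * (b * (c * d)) ≡ (a * d) * (b * c)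
      shuffle₂ = solve-∀
      left : p ^ e * q ^ f ≡ P ^ t * X
      left = begin-equality
        p ^ e * q ^ f
          ≡⟨ cong₂ _*_ (^-*-assoc P (suc N + N) e) (^-*-assoc Q (suc N + N) f) ⟩
        P ^ ((suc N + N) * e) * Q ^ ((suc N + N) * f)
          ≡⟨ cong (λ z → P ^ z * Q ^ ((suc N + N) * f)) (trans (expand₁ N e)
               (trans (cong (suc N * e +_) Ne≡) (expand₂ N e f t))) ⟩
        P ^ (suc N * (e + f) + t) * Q ^ ((suc N + N) * f)
          ≡⟨ cong (_* Q ^ ((suc N + N) * f)) (^-distribˡ-+-* P (suc N * (e + f)) t) ⟩
        P ^ (suc N * (e + f)) * P ^ t * Q ^ ((suc N + N) * f)
          ≡⟨ shuffle₁ (P ^ t) (P ^ (suc N * (e + f))) _ ⟨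
        P ^ t * X ∎
      right : 2 ^ s * D ^ (e + f) ≡ (2 ^ s * Q ^ t) * X
      right = begin-equality
        2 ^ s * D ^ (e + f)
          ≡⟨ cong (2 ^ s *_) (trans (^-distribʳ-* (e + f) (P ^ suc N) (Q ^ N))
               (cong₂ _*_ (^-*-assoc P (suc N) (e + f)) (^-*-assoc Q N (e + f)))) ⟩
        2 ^ s * (P ^ (suc N * (e + f)) * Q ^ (N * (e + f)))
          ≡⟨ cong (λ z → 2 ^ s * (P ^ (suc N * (e + f)) * Q ^ z))
               (trans (*-distribˡ-+ N e f) (trans (cong (_+ N * f) Ne≡) (expand₃ N f t))) ⟩
        2 ^ s * (P ^ (suc N * (e + f)) * Q ^ ((suc N + N) * f + t))
          ≡⟨ cong (λ z → 2 ^ s * (P ^ (suc N * (e + f)) * z)) (^-distribˡ-+-* Q ((suc N + N) * f) t) ⟩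
        2 ^ s * (P ^ (suc N * (e + f)) * (Q ^ ((suc N + N) * f) * Q ^ t))
          ≡⟨ shuffle₂ (2 ^ s) (P ^ (suc N * (e + f))) (Q ^ ((suc N + N) * f)) (Q ^ t) ⟩
        (2 ^ s * Q ^ t) * X ∎
      P^t≤ : P ^ t ≤ 2 ^ s * Q ^ t
      P^t≤ = *-cancelʳ-≤ _ _ X {{m*n≢0 _ _ {{m^n≢0 P (suc N * (e + f))}} {{m^n≢0 Q ((suc N + N) * f)}}}}
        (subst (_≤ (2 ^ s * Q ^ t) * X) left (subst (p ^ e * q ^ f ≤_) right bound))

    balancedOrientation : ∀ k l .{{_ : NonZero k}} → 4 * k ≤ 2 ^ l → ∃[ t ] (∀ (A B : Vec Bool k) →
      (suc N + N) * forward t A B ≤ suc N * (size A * size B) + Q * (2 + l * (size A + size B)))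
    balancedOrientation k l 4k≤2^l = t , λ A B → linear A B
      where
      open ≤-Reasoning
      -- The exponent k of a square becomes j. Writing K as `j + j` makes `compound-interest j j`
      -- bound (1 + 1 / K)ʲ by exactly 2.
      j = 2 * k
      K = j + j
      open Potential K p q D p+q≤2D pq≤D²
      t = proj₁ (lightOrientation k)
      instance
        j≢0 : NonZero j
        j≢0 = m*n≢0 2 k
        K≢0 : NonZero K
        K≢0 = >-nonZero (≤-trans (>-nonZero⁻¹ j) (m≤m+n j j))
        D≢0 : NonZero D
        D≢0 = m*n≢0 (P ^ suc N) (Q ^ N) {{m^n≢0 P (suc N)}} {{m^n≢0 Q N}}
      square^ : ∀ X → (X * X) ^ k ≡ X ^ j
      square^ X = trans (cong (λ Y → (X * Y) ^ k) (sym (*-identityʳ X))) (^-*-assoc X 2 k)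
      growth : (1 + K) ^ j ≤ 2 * K ^ j
      growth = *-cancelʳ-≤ _ _ j (≤-trans (compound-interest j j) (≤-reflexive (eq (K ^ j) j)))
        where
        eq : ∀ a b → a * (b + b) ≡ 2 * a * b
        eq = solve-∀
      K≤2^l : K ≤ 2 ^ l
      K≤2^l = ≤-trans (≤-reflexive (eq k)) 4k≤2^l
        where
        eq : ∀ k → 2 * k + 2 * k ≡ 4 * k
        eq = solve-∀
      shuffle : ∀ a b c → 2 * a * b * c ≡ 2 * b * c * a
      shuffle = solve-∀
      powers : ∀ A B → p ^ forward t A B * q ^ backward t A B ≤
        2 ^ (1 + l * (size A + size B)) * D ^ (forward t A B + backward t A B)
      powers A B = *-cancelʳ-≤ _ _ (K ^ j) {{m^n≢0 K j}} (begin
        p ^ e * q ^ f * K ^ j              ≡⟨ cong (p ^ e * q ^ f *_) (square^ K) ⟨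
        p ^ e * q ^ f * (K * K) ^ k        ≤⟨ light⇒balanced t D≢0 (proj₂ (lightOrientation k)) A B ⟩
        ((1 + K) * (1 + K)) ^ k * K ^ n * D ^ (e + f)
          ≤⟨ *-monoˡ-≤ (D ^ (e + f)) (*-mono-≤ (≤-trans (≤-reflexive (square^ (1 + K))) growth)
               (≤-trans (^-monoˡ-≤ n K≤2^l) (≤-reflexive (^-*-assoc 2 l n)))) ⟩
        2 * K ^ j * 2 ^ (l * n) * D ^ (e + f)
          ≡⟨ shuffle (K ^ j) (2 ^ (l * n)) (D ^ (e + f)) ⟩
        2 ^ (1 + l * n) * D ^ (e + f) * K ^ j ∎)
        where
        e = forward t A B
        f = backward t A B
        n = size A + size B
      regroup : ∀ N e f c → (1 + N) * e + ((1 + N) * f + c) ≡ (1 + N) * (e + f) + c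
      regroup = solve-∀
      split : ∀ N e → (1 + N + N) * e ≡ (1 + N) * e + N * e
      split = solve-∀
      linear : ∀ A B → (suc N + N) * forward t A B ≤ suc N * (size A * size B) + Q * (2 + l * (size A + size B))
      linear A B = begin
        -- Adding (N + 1) e to both sides replaces f by e + f, which `total≤` bounds. In the
        -- constant 2, one unit is the factor 2 from `growth`, the other the rounding in
        -- `exponent<`.
        (suc N + N) * e                                     ≡⟨ split N e ⟩
        suc N * e + N * e                                   ≤⟨ +-monoʳ-≤ (suc N * e) (exponents (1 + l * n) e f (powers A B)) ⟩
        suc N * e + (suc N * f + Q * (2 + l * n))           ≡⟨ regroup N e f (Q * (2 + l * n)) ⟩
        suc N * (e + f) + Q * (2 + l * n)                   ≤⟨ +-monoˡ-≤ (Q * (2 + l * n)) (*-monoʳ-≤ (suc N) (total≤ t A B)) ⟩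
        suc N * (size A * size B) + Q * (2 + l * n)         ∎
        where
        e = forward t A B
        f = backward t A B
        n = size A + size B

open Counting

open import Defs
open import Data.Fin using (Fin; zero; suc)
open import Data.Integer using (+_)
import Data.Integer.Base as ℤ
import Data.Integer.Properties as ℤP
import Data.Integer.Tactic.RingSolver as ℤSolver
open import Data.Nat using (ℕ; zero; suc; s≤s; z≤n) renaming (_≤_ to _≤ℕ_; _^_ to _^ℕ_)
open import Data.Product using (Σ-syntax)
open import Data.Rational using (ℚ; 0ℚ; 1ℚ; ½; _/_; nonNegative)
import Data.Rational.Base as ℚ
import Data.Rational.Properties as ℚP
import Data.Rational.Solver as ℚSolver
import Data.Rational.Unnormalised.Base as ℚᵘ
import Data.Rational.Unnormalised.Properties as ℚᵘP

open SemiringSum (CommutativeRing.semiring ℚP.+-*-commutativeRing) using (sum; sum-cong-≗; ∑-distrib-+; ∑-comm; *-distribˡ-sum)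
open ℚSolver.+-*-Solver using (solve; con; :-_; _:+_; _:*_; _:-_; _:=_)
open Halving
open Scaling
open RiemannSums

-- Inequalities between real numbers

infixl 6 _-_

_-_ : ℝ → ℝ → ℝ
x - y = x + fromℚ (ℚ.- 1ℚ) * y

pointwise-≤ : ∀ {x y} → (∀ n → seq x n ℚ.≤ seq y n) → x ≤ y
pointwise-≤ {x} {y} x≤y ε 0<ε = 0 , λ n _ →
  ℚP.≤-trans (x≤y n) (subst (ℚ._≤ seq y n ℚ.+ ε) (ℚP.+-identityʳ (seq y n)) (ℚP.+-monoʳ-≤ (seq y n) (ℚP.<⇒≤ 0<ε)))

≤-resp-pointwise : ∀ {x x′ y y′} → (∀ n → seq x n ≡ seq x′ n) → (∀ n → seq y n ≡ seq y′ n) → x ≤ y → x′ ≤ y′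
≤-resp-pointwise x≡x′ y≡y′ x≤y ε 0<ε =
  let N , bound = x≤y ε 0<ε
  in N , λ n N≤n → subst₂ (λ p q → p ℚ.≤ q ℚ.+ ε) (x≡x′ n) (y≡y′ n) (bound n N≤n)

+-nonneg : ∀ {x y} → 0ℝ ≤ x → 0ℝ ≤ y → 0ℝ ≤ x + y
+-nonneg {x} {y} 0≤x 0≤y ε 0<ε =
  let M , x-bound = 0≤x (½ ℚ.* ε) (half-pos 0<ε)
      N , y-bound = 0≤y (½ ℚ.* ε) (half-pos 0<ε)
  in M ℕ.⊔ N , λ n M⊔N≤n → begin
    0ℚ ℚ.+ 0ℚ
      ≤⟨ ℚP.+-mono-≤ (x-bound n (ℕP.m⊔n≤o⇒m≤o M N M⊔N≤n)) (y-bound n (ℕP.m⊔n≤o⇒n≤o M N M⊔N≤n)) ⟩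
    (seq x n ℚ.+ ½ ℚ.* ε) ℚ.+ (seq y n ℚ.+ ½ ℚ.* ε)
      ≡⟨ interchange (seq x n) (seq y n) (½ ℚ.* ε) ⟩
    seq x n ℚ.+ seq y n ℚ.+ (½ ℚ.* ε ℚ.+ ½ ℚ.* ε)
      ≡⟨ cong (seq x n ℚ.+ seq y n ℚ.+_) (halves ε) ⟩
    seq x n ℚ.+ seq y n ℚ.+ ε ∎
  where
  open ℚP.≤-Reasoning
  interchange : ∀ a b c → (a ℚ.+ c) ℚ.+ (b ℚ.+ c) ≡ a ℚ.+ b ℚ.+ (c ℚ.+ c)
  interchange = solve 3 (λ a b c → (a :+ c) :+ (b :+ c) := a :+ b :+ (c :+ c)) refl

module ProductBound where
  open ℚP.≤-Reasoning

  0≤p+q⇒-p≤q : ∀ p q → 0ℚ ℚ.≤ p ℚ.+ q → ℚ.- p ℚ.≤ q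
  0≤p+q⇒-p≤q p q 0≤p+q = begin
    ℚ.- p                  ≡⟨ ℚP.+-identityʳ (ℚ.- p) ⟨
    ℚ.- p ℚ.+ 0ℚ           ≤⟨ ℚP.+-monoʳ-≤ (ℚ.- p) 0≤p+q ⟩
    ℚ.- p ℚ.+ (p ℚ.+ q)    ≡⟨ cancel p q ⟩
    q                      ∎
    where
    cancel : ∀ p q → ℚ.- p ℚ.+ (p ℚ.+ q) ≡ q
    cancel = solve 2 (λ p q → :- p :+ (p :+ q) := q) refl

  -- Terms of a nonnegative real may be slightly negative. If p ≥ 0 then p q ≥ -p δ ≥ -A δ; if p ≤ 0
  -- then -p ≤ δ and q ≤ B give p q ≥ -B δ. The sign of the rational p can be decided, that of a
  -- real cannot.
  nonneg-*-almost : ∀ p q A B δ → 0ℚ ℚ.< A → 0ℚ ℚ.< B → 0ℚ ℚ.< δ →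
    ℚ.∣ p ∣ ℚ.≤ A → ℚ.∣ q ∣ ℚ.≤ B → 0ℚ ℚ.≤ p ℚ.+ δ → 0ℚ ℚ.≤ q ℚ.+ δ →
    0ℚ ℚ.≤ p ℚ.* q ℚ.+ (A ℚ.+ B) ℚ.* δ
  nonneg-*-almost p q A B δ 0<A 0<B 0<δ p≤A q≤B 0≤p+δ 0≤q+δ with ℚP.≤-total 0ℚ p
  ... | inj₁ 0≤p = begin
    0ℚ                                ≡⟨ ℚP.*-zeroʳ p ⟨
    p ℚ.* 0ℚ                          ≤⟨ ℚP.*-monoˡ-≤-nonNeg p {{nonNegative 0≤p}} 0≤q+δ ⟩
    p ℚ.* (q ℚ.+ δ)                   ≡⟨ ℚP.*-distribˡ-+ p q δ ⟩
    p ℚ.* q ℚ.+ p ℚ.* δ               ≤⟨ ℚP.+-monoʳ-≤ (p ℚ.* q) (ℚP.*-monoʳ-≤-nonNeg δ {{nonNegative (ℚP.<⇒≤ 0<δ)}} p≤A+B) ⟩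
    p ℚ.* q ℚ.+ (A ℚ.+ B) ℚ.* δ       ∎
    where
    p≤A+B : p ℚ.≤ A ℚ.+ B
    p≤A+B = begin
      p          ≡⟨ ℚP.0≤p⇒∣p∣≡p 0≤p ⟨
      ℚ.∣ p ∣    ≤⟨ p≤A ⟩
      A          ≡⟨ ℚP.+-identityʳ A ⟨
      A ℚ.+ 0ℚ   ≤⟨ ℚP.+-monoʳ-≤ A (ℚP.<⇒≤ 0<B) ⟩
      A ℚ.+ B    ∎
  ... | inj₂ p≤0 = begin
    0ℚ                                ≡⟨ ℚP.*-zeroʳ -p ⟨
    -p ℚ.* 0ℚ                         ≤⟨ ℚP.*-monoˡ-≤-nonNeg -p {{nonNegative 0≤-p}} 0≤B-q ⟩
    -p ℚ.* (B ℚ.- q)                  ≡⟨ expand p q B ⟩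
    p ℚ.* q ℚ.+ -p ℚ.* B              ≤⟨ ℚP.+-monoʳ-≤ (p ℚ.* q) (ℚP.*-monoʳ-≤-nonNeg B {{nonNegative (ℚP.<⇒≤ 0<B)}} (0≤p+q⇒-p≤q p δ 0≤p+δ)) ⟩
    p ℚ.* q ℚ.+ δ ℚ.* B               ≡⟨ cong (p ℚ.* q ℚ.+_) (ℚP.*-comm δ B) ⟩
    p ℚ.* q ℚ.+ B ℚ.* δ               ≤⟨ ℚP.+-monoʳ-≤ (p ℚ.* q) (ℚP.*-monoʳ-≤-nonNeg δ {{nonNegative (ℚP.<⇒≤ 0<δ)}} B≤A+B) ⟩
    p ℚ.* q ℚ.+ (A ℚ.+ B) ℚ.* δ       ∎
    where
    -p = ℚ.- p
    0≤-p : 0ℚ ℚ.≤ -p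
    0≤-p = ℚP.neg-antimono-≤ p≤0
    q≤B′ : q ℚ.≤ B
    q≤B′ with ℚP.≤-total 0ℚ q
    ... | inj₁ 0≤q = subst (ℚ._≤ B) (ℚP.0≤p⇒∣p∣≡p 0≤q) q≤B
    ... | inj₂ q≤0 = ℚP.≤-trans q≤0 (ℚP.<⇒≤ 0<B)
    0≤B-q : 0ℚ ℚ.≤ B ℚ.- q
    0≤B-q = subst (ℚ._≤ B ℚ.- q) (ℚP.+-inverseʳ q) (ℚP.+-monoˡ-≤ (ℚ.- q) q≤B′)
    expand : ∀ p q B → (ℚ.- p) ℚ.* (B ℚ.- q) ≡ p ℚ.* q ℚ.+ (ℚ.- p) ℚ.* B
    expand = solve 3 (λ p q B → (:- p) :* (B :- q) := p :* q :+ (:- p) :* B) refl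
    B≤A+B : B ℚ.≤ A ℚ.+ B
    B≤A+B = subst (ℚ._≤ A ℚ.+ B) (ℚP.+-identityˡ B) (ℚP.+-monoˡ-≤ B (ℚP.<⇒≤ 0<A))

*-nonneg : ∀ {x y} → 0ℝ ≤ x → 0ℝ ≤ y → 0ℝ ≤ x * y
*-nonneg {x} {y} 0≤x 0≤y ε 0<ε =
  let A , 0<A , K , x≤A = eventuallyBounded {seq x} (cauchy x)
      B , 0<B , L , y≤B = eventuallyBounded {seq y} (cauchy y)
      δ , 0<δ , [A+B]δ≡ε = scale (A ℚ.+ B) ε (ℚP.+-mono-< 0<A 0<B) 0<ε
      M , x-bound = 0≤x δ 0<δ
      N , y-bound = 0≤y δ 0<δ
  in (K ℕ.⊔ L) ℕ.⊔ (M ℕ.⊔ N) , λ n P≤n →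
    let K⊔L≤n = ℕP.m⊔n≤o⇒m≤o (K ℕ.⊔ L) (M ℕ.⊔ N) P≤n
        M⊔N≤n = ℕP.m⊔n≤o⇒n≤o (K ℕ.⊔ L) (M ℕ.⊔ N) P≤n
    in subst (λ η → 0ℚ ℚ.≤ seq x n ℚ.* seq y n ℚ.+ η) [A+B]δ≡ε
         (ProductBound.nonneg-*-almost (seq x n) (seq y n) A B δ 0<A 0<B 0<δ
           (x≤A n (ℕP.m⊔n≤o⇒m≤o K L K⊔L≤n)) (y≤B n (ℕP.m⊔n≤o⇒n≤o K L K⊔L≤n))
           (x-bound n (ℕP.m⊔n≤o⇒m≤o M N M⊔N≤n)) (y-bound n (ℕP.m⊔n≤o⇒n≤o M N M⊔N≤n)))

square-nonneg : ∀ x → 0ℝ ≤ x * x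
square-nonneg x = pointwise-≤ {0ℝ} {x * x} λ n → square (seq x n)
  where
  square : ∀ p → 0ℚ ℚ.≤ p ℚ.* p
  square p with ℚP.≤-total 0ℚ p
  ... | inj₁ 0≤p = subst (ℚ._≤ p ℚ.* p) (ℚP.*-zeroʳ p) (ℚP.*-monoˡ-≤-nonNeg p {{nonNegative 0≤p}} 0≤p)
  ... | inj₂ p≤0 = subst (ℚ._≤ p ℚ.* p) (ℚP.*-zeroʳ p) (ℚP.*-monoˡ-≤-nonPos p {{ℚ.nonPositive p≤0}} p≤0)

≤⇒0≤- : ∀ {x y} → x ≤ y → 0ℝ ≤ y - x
≤⇒0≤- {x} {y} x≤y ε 0<ε =
  let N , bound = x≤y ε 0<ε
  in N , λ n N≤n → subst₂ ℚ._≤_ (left (seq x n)) (right (seq x n) (seq y n) ε)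
       (ℚP.+-monoʳ-≤ (ℚ.- 1ℚ ℚ.* seq x n) (bound n N≤n))
  where
  left : ∀ p → ℚ.- 1ℚ ℚ.* p ℚ.+ p ≡ 0ℚ
  left = solve 1 (λ p → con (ℚ.- 1ℚ) :* p :+ p := con 0ℚ) refl
  right : ∀ p q ε → ℚ.- 1ℚ ℚ.* p ℚ.+ (q ℚ.+ ε) ≡ q ℚ.+ ℚ.- 1ℚ ℚ.* p ℚ.+ ε
  right = solve 3 (λ p q ε → con (ℚ.- 1ℚ) :* p :+ (q :+ ε) := q :+ con (ℚ.- 1ℚ) :* p :+ ε) refl

-- Turns an inequality of reals into a certificate: a nonnegative slack and a ring identity that
-- holds term by term over ℚ.
≤-by-slack : ∀ {x y} s → 0ℝ ≤ s → (∀ n → seq y n ≡ seq x n ℚ.+ seq s n) → x ≤ y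
≤-by-slack {x} {y} s 0≤s y≡x+s ε 0<ε =
  let N , bound = 0≤s ε 0<ε
  in N , λ n N≤n → subst₂ ℚ._≤_ (ℚP.+-identityʳ (seq x n))
       (trans (sym (ℚP.+-assoc (seq x n) (seq s n) ε)) (cong (ℚ._+ ε) (sym (y≡x+s n))))
       (ℚP.+-monoʳ-≤ (seq x n) (bound n N≤n))

fromℚ-mono-≤ : ∀ {p q} → p ℚ.≤ q → fromℚ p ≤ fromℚ q
fromℚ-mono-≤ {p} {q} p≤q = pointwise-≤ {fromℚ p} {fromℚ q} λ _ → p≤q

seq-∑ : ∀ {k} (f : Fin k → ℝ) n → seq (∑ f) n ≡ sum (λ i → seq (f i) n)
seq-∑ {zero}  f n = refl
seq-∑ {suc k} f n = cong (seq (f zero) n ℚ.+_) (seq-∑ (λ i → f (suc i)) n)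

∑-nonneg : ∀ {k} {f : Fin k → ℝ} → (∀ i → 0ℝ ≤ f i) → 0ℝ ≤ ∑ f
∑-nonneg {zero}  0≤f = fromℚ-mono-≤ ℚP.≤-refl
∑-nonneg {suc k} {f} 0≤f = +-nonneg {f zero} {∑ (λ i → f (suc i))} (0≤f zero) (∑-nonneg λ i → 0≤f (suc i))

-- Affine functions on the cube

indicator : ∀ {k} → Vec Bool k → Fin k → ℝ
indicator A i = fromℚ (if lookup A i then 1ℚ else 0ℚ)

-- The slack is the convex combination, with coefficients f and 1 - f, of the slacks at f = 1 and f
-- = 0. No decision on the sign of `h` is made.
interpolate : ∀ {f h s c} → 0ℝ ≤ f → f ≤ 1ℝ → s ≤ c → s ≤ c - h → f * h + s ≤ c
interpolate {f} {h} {s} {c} 0≤f f≤1 s≤c s≤c-h =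
  ≤-by-slack {f * h + s} {c} (f * ((c - h) - s) + (1ℝ - f) * (c - s))
    (+-nonneg {f * ((c - h) - s)} {(1ℝ - f) * (c - s)}
      (*-nonneg {f} {(c - h) - s} 0≤f (≤⇒0≤- {s} {c - h} s≤c-h))
      (*-nonneg {1ℝ - f} {c - s} (≤⇒0≤- {f} {1ℝ} f≤1) (≤⇒0≤- {s} {c} s≤c)))
    (λ n → identity (seq c n) (seq f n) (seq h n) (seq s n))
  where
  identity : ∀ c f h s → c ≡ f ℚ.* h ℚ.+ s ℚ.+
    (f ℚ.* (c ℚ.+ ℚ.- 1ℚ ℚ.* h ℚ.+ ℚ.- 1ℚ ℚ.* s) ℚ.+ (1ℚ ℚ.+ ℚ.- 1ℚ ℚ.* f) ℚ.* (c ℚ.+ ℚ.- 1ℚ ℚ.* s))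
  identity = solve 4 (λ c f h s → c := f :* h :+ s :+
    (f :* (c :+ con (ℚ.- 1ℚ) :* h :+ con (ℚ.- 1ℚ) :* s) :+ (con 1ℚ :+ con (ℚ.- 1ℚ) :* f) :* (c :+ con (ℚ.- 1ℚ) :* s))) refl

∑-cong-seq : ∀ {k} {u v : Fin k → ℝ} → (∀ i n → seq (u i) n ≡ seq (v i) n) → ∀ n → seq (∑ u) n ≡ seq (∑ v) n
∑-cong-seq {zero}  u≡v n = refl
∑-cong-seq {suc k} u≡v n = cong₂ ℚ._+_ (u≡v zero n) (∑-cong-seq (λ i → u≡v (suc i)) n)

module _ {k} (e h : Fin (suc k) → ℝ) (e′ : Fin k → ℝ) (c : ℝ) (e≡e′ : ∀ i n → seq (e (suc i)) n ≡ seq (e′ i) n) where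
  private
    V V′ : ℝ
    V  = ∑ (λ i → e i * h i)
    V′ = ∑ (λ i → e′ i * h (suc i))

    V≡ : ∀ n → seq V n ≡ seq (e zero) n ℚ.* seq (h zero) n ℚ.+ seq V′ n
    V≡ n = cong (seq (e zero) n ℚ.* seq (h zero) n ℚ.+_)
      (∑-cong-seq {u = λ i → e (suc i) * h (suc i)} {v = λ i → e′ i * h (suc i)} (λ i n → cong (ℚ._* seq (h (suc i)) n) (e≡e′ i n)) n)

  restrict₀ : (∀ n → seq (e zero) n ≡ 0ℚ) → ∑ (λ i → e i * h i) ≤ c → ∑ (λ i → e′ i * h (suc i)) ≤ c
  restrict₀ e≡0 = ≤-resp-pointwise {V} {V′} {c} {c} (λ n → trans (V≡ n)
    (trans (cong (λ z → z ℚ.* seq (h zero) n ℚ.+ seq V′ n) (e≡0 n)) (drop (seq (h zero) n) (seq V′ n)))) (λ n → refl)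
    where
    drop : ∀ p q → 0ℚ ℚ.* p ℚ.+ q ≡ q
    drop = solve 2 (λ p q → con 0ℚ :* p :+ q := q) refl

  restrict₁ : (∀ n → seq (e zero) n ≡ 1ℚ) → ∑ (λ i → e i * h i) ≤ c → ∑ (λ i → e′ i * h (suc i)) ≤ c - h zero
  restrict₁ e≡1 V≤c = ≤-by-slack {V′} {c - h zero} (c - V) (≤⇒0≤- {V} {c} V≤c)
    (λ n → trans (move (seq c n) (seq (h zero) n) (seq V′ n))
      (cong (λ z → seq V′ n ℚ.+ (seq c n ℚ.+ ℚ.- 1ℚ ℚ.* z))
        (sym (trans (V≡ n) (cong (λ z → z ℚ.* seq (h zero) n ℚ.+ seq V′ n) (e≡1 n))))))
    where
    move : ∀ c h v → c ℚ.+ ℚ.- 1ℚ ℚ.* h ≡ v ℚ.+ (c ℚ.+ ℚ.- 1ℚ ℚ.* (1ℚ ℚ.* h ℚ.+ v))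
    move = solve 3 (λ c h v → c :+ con (ℚ.- 1ℚ) :* h := v :+ (c :+ con (ℚ.- 1ℚ) :* (con 1ℚ :* h :+ v))) refl

∑-empty : ∀ (u v : Fin 0 → ℝ) c → ∑ u ≤ c → ∑ v ≤ c
∑-empty u v c = ≤-resp-pointwise {∑ u} {∑ v} {c} {c} (λ n → refl) (λ n → refl)

-- Induction on the coordinates with `c` general: head bit 0 keeps the bound, head bit 1 lowers it
-- to `c - h zero`, and `interpolate` joins the two.
affine≤-on-cube : ∀ {k} (h : Fin k → ℝ) (c : ℝ) → (∀ (A : Vec Bool k) → ∑ (λ i → indicator A i * h i) ≤ c) →
  ∀ (f : Fin k → ℝ) → (∀ i → 0ℝ ≤ f i) → (∀ i → f i ≤ 1ℝ) → ∑ (λ i → f i * h i) ≤ c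
affine≤-on-cube {zero}  h c vertices f 0≤f f≤1 = ∑-empty (λ i → indicator [] i * h i) (λ i → f i * h i) c (vertices [])
affine≤-on-cube {suc k} h c vertices f 0≤f f≤1 =
  interpolate {f zero} {h zero} {∑ (λ i → f (suc i) * h (suc i))} {c} (0≤f zero) (f≤1 zero)
    (affine≤-on-cube (λ i → h (suc i)) c
      (λ A → restrict₀ (indicator (false ∷ A)) h (indicator A) c (λ i n → refl) (λ n → refl) (vertices (false ∷ A)))
      (λ i → f (suc i)) (λ i → 0≤f (suc i)) (λ i → f≤1 (suc i)))
    (affine≤-on-cube (λ i → h (suc i)) (c - h zero)
      (λ A → restrict₁ (indicator (true ∷ A)) h (indicator A) c (λ i n → refl) (λ n → refl) (vertices (true ∷ A)))
      (λ i → f (suc i)) (λ i → 0≤f (suc i)) (λ i → f≤1 (suc i)))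

-- From the vertices of the cube to the whole cube

module Bilinear {k : ℕ} (E : Fin k → Fin k → Bool) (a b c d : ℚ) where

  form : (f g : Fin k → ℝ) → ℝ
  form f g = ∑ λ i → ∑ λ j → if E i j then f i * g j else 0ℝ

  Bounded : (f g : Fin k → ℝ) → Set
  Bounded f g = fromℚ a * form f g ≤ fromℚ b * (∑ f * ∑ g) + fromℚ c * (∑ f + ∑ g) + fromℚ d

  -- The coefficient of one variable when all terms of `Bounded` containing the other function's
  -- products are moved to the left; `e` is a row of `E` for a variable of f, a column for one of g.
  -- What stays on the right is c times the sum of the fixed function, plus d.
  slope : (u : Fin k → ℝ) → (Fin k → Bool) → ℝ
  slope u e = fromℚ a * ∑ (λ j → if e j then u j else 0ℝ) - (fromℚ b * ∑ u + fromℚ c)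

  seq-slope-sum : ∀ (u v : Fin k → ℝ) (e : Fin k → Fin k → Bool) n →
    seq (∑ (λ i → u i * slope v (e i))) n ≡
    a ℚ.* sum (λ i → sum (λ j → if e i j then seq (u i) n ℚ.* seq (v j) n else 0ℚ))
      ℚ.+ ℚ.- 1ℚ ℚ.* ((b ℚ.* seq (∑ v) n ℚ.+ c) ℚ.* seq (∑ u) n)
  seq-slope-sum u v e n = begin
    seq (∑ (λ i → u i * slope v (e i))) n
      ≡⟨ seq-∑ (λ i → u i * slope v (e i)) n ⟩
    sum (λ i → x i ℚ.* (a ℚ.* seq (∑ (λ j → if e i j then v j else 0ℝ)) n ℚ.+ ℚ.- 1ℚ ℚ.* B))
      ≡⟨ sum-cong-≗ (λ i → cong (λ z → x i ℚ.* (a ℚ.* z ℚ.+ ℚ.- 1ℚ ℚ.* B)) (inner i)) ⟩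
    sum (λ i → x i ℚ.* (a ℚ.* s i ℚ.+ ℚ.- 1ℚ ℚ.* B))
      ≡⟨ sum-cong-≗ (λ i → expand (x i) a (s i) B) ⟩
    sum (λ i → a ℚ.* (x i ℚ.* s i) ℚ.+ (ℚ.- 1ℚ ℚ.* B) ℚ.* x i)
      ≡⟨ ∑-distrib-+ (λ i → a ℚ.* (x i ℚ.* s i)) (λ i → (ℚ.- 1ℚ ℚ.* B) ℚ.* x i) ⟩
    sum (λ i → a ℚ.* (x i ℚ.* s i)) ℚ.+ sum (λ i → (ℚ.- 1ℚ ℚ.* B) ℚ.* x i)
      ≡⟨ cong₂ ℚ._+_ (*-distribˡ-sum a (λ i → x i ℚ.* s i)) (*-distribˡ-sum (ℚ.- 1ℚ ℚ.* B) x) ⟨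
    a ℚ.* sum (λ i → x i ℚ.* s i) ℚ.+ (ℚ.- 1ℚ ℚ.* B) ℚ.* sum x
      ≡⟨ cong₂ (λ y z → a ℚ.* y ℚ.+ z) (sum-cong-≗ outer)
           (trans (ℚP.*-assoc (ℚ.- 1ℚ) B (sum x)) (cong (λ z → ℚ.- 1ℚ ℚ.* (B ℚ.* z)) (sym (seq-∑ u n)))) ⟩
    a ℚ.* sum (λ i → sum (λ j → if e i j then x i ℚ.* y j else 0ℚ)) ℚ.+ ℚ.- 1ℚ ℚ.* (B ℚ.* seq (∑ u) n) ∎
    where
    open ≡-Reasoning
    x y s : Fin k → ℚ
    x i = seq (u i) n
    y j = seq (v j) n
    s i = sum (λ j → if e i j then y j else 0ℚ)
    B = b ℚ.* seq (∑ v) n ℚ.+ c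
    inner : ∀ i → seq (∑ (λ j → if e i j then v j else 0ℝ)) n ≡ s i
    inner i = trans (seq-∑ (λ j → if e i j then v j else 0ℝ) n) (sum-cong-≗ λ j → if-float (λ z → seq z n) (e i j) {v j} {0ℝ})
    expand : ∀ x a s B → x ℚ.* (a ℚ.* s ℚ.+ ℚ.- 1ℚ ℚ.* B) ≡ a ℚ.* (x ℚ.* s) ℚ.+ (ℚ.- 1ℚ ℚ.* B) ℚ.* x
    expand = solve 4 (λ x a s B → x :* (a :* s :+ con (ℚ.- 1ℚ) :* B) := a :* (x :* s) :+ (con (ℚ.- 1ℚ) :* B) :* x) refl
    times : ∀ t z w → t ℚ.* (if w then z else 0ℚ) ≡ (if w then t ℚ.* z else 0ℚ)
    times t z true  = refl
    times t z false = ℚP.*-zeroʳ t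
    outer : ∀ i → x i ℚ.* s i ≡ sum (λ j → if e i j then x i ℚ.* y j else 0ℚ)
    outer i = trans (*-distribˡ-sum (x i) (λ j → if e i j then y j else 0ℚ)) (sum-cong-≗ λ j → times (x i) (y j) (e i j))

  seq-form : ∀ (f g : Fin k → ℝ) n → seq (form f g) n ≡ sum (λ i → sum (λ j → if E i j then seq (f i) n ℚ.* seq (g j) n else 0ℚ))
  seq-form f g n = trans (seq-∑ (λ i → ∑ λ j → if E i j then f i * g j else 0ℝ) n) (sum-cong-≗ λ i →
    trans (seq-∑ (λ j → if E i j then f i * g j else 0ℝ) n) (sum-cong-≗ λ j →
      if-float (λ z → seq z n) (E i j) {f i * g j} {0ℝ}))

  seq-slopeˡ : ∀ (f g : Fin k → ℝ) n → seq (∑ (λ i → f i * slope g (E i))) n ≡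
    a ℚ.* seq (form f g) n ℚ.+ ℚ.- 1ℚ ℚ.* ((b ℚ.* seq (∑ g) n ℚ.+ c) ℚ.* seq (∑ f) n)
  seq-slopeˡ f g n = trans (seq-slope-sum f g E n)
    (cong (λ z → a ℚ.* z ℚ.+ ℚ.- 1ℚ ℚ.* ((b ℚ.* seq (∑ g) n ℚ.+ c) ℚ.* seq (∑ f) n)) (sym (seq-form f g n)))

  seq-slopeʳ : ∀ (f g : Fin k → ℝ) n → seq (∑ (λ j → g j * slope f (λ i → E i j))) n ≡
    a ℚ.* seq (form f g) n ℚ.+ ℚ.- 1ℚ ℚ.* ((b ℚ.* seq (∑ f) n ℚ.+ c) ℚ.* seq (∑ g) n)
  seq-slopeʳ f g n = trans (seq-slope-sum g f (λ j i → E i j) n)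
    (cong (λ z → a ℚ.* z ℚ.+ ℚ.- 1ℚ ℚ.* ((b ℚ.* seq (∑ f) n ℚ.+ c) ℚ.* seq (∑ g) n))
      (trans (∑-comm (λ j i → if E i j then seq (g j) n ℚ.* seq (f i) n else 0ℚ))
        (trans (sum-cong-≗ λ i → sum-cong-≗ λ j → cong (λ z → if E i j then z else 0ℚ) (ℚP.*-comm (seq (g j) n) (seq (f i) n)))
          (sym (seq-form f g n)))))

  module _ (f g : Fin k → ℝ) where
    private
      bound : ℝ
      bound = fromℚ b * (∑ f * ∑ g) + fromℚ c * (∑ f + ∑ g) + fromℚ d
      left right : ℝ
      left  = ∑ (λ i → f i * slope g (E i))
      right = ∑ (λ j → g j * slope f (λ i → E i j))

      to : ∀ S F G → b ℚ.* (F ℚ.* G) ℚ.+ c ℚ.* (F ℚ.+ G) ℚ.+ d ≡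
        a ℚ.* S ℚ.+ ((c ℚ.* G ℚ.+ d) ℚ.+ ℚ.- 1ℚ ℚ.* (a ℚ.* S ℚ.+ ℚ.- 1ℚ ℚ.* ((b ℚ.* G ℚ.+ c) ℚ.* F)))
      to S F G = solve 7 (λ S F G a b c d → b :* (F :* G) :+ c :* (F :+ G) :+ d :=
        a :* S :+ ((c :* G :+ d) :+ con (ℚ.- 1ℚ) :* (a :* S :+ con (ℚ.- 1ℚ) :* ((b :* G :+ c) :* F)))) refl S F G a b c d

      from : ∀ S F G → c ℚ.* F ℚ.+ d ≡
        (a ℚ.* S ℚ.+ ℚ.- 1ℚ ℚ.* ((b ℚ.* F ℚ.+ c) ℚ.* G)) ℚ.+
        ((b ℚ.* (F ℚ.* G) ℚ.+ c ℚ.* (F ℚ.+ G) ℚ.+ d) ℚ.+ ℚ.- 1ℚ ℚ.* (a ℚ.* S))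
      from S F G = solve 7 (λ S F G a b c d → c :* F :+ d :=
        (a :* S :+ con (ℚ.- 1ℚ) :* ((b :* F :+ c) :* G)) :+
        ((b :* (F :* G) :+ c :* (F :+ G) :+ d) :+ con (ℚ.- 1ℚ) :* (a :* S))) refl S F G a b c d

      swapped : ∀ F G → b ℚ.* (F ℚ.* G) ℚ.+ c ℚ.* (F ℚ.+ G) ℚ.+ d ≡ b ℚ.* (G ℚ.* F) ℚ.+ c ℚ.* (G ℚ.+ F) ℚ.+ d
      swapped F G = cong₂ (λ x y → b ℚ.* x ℚ.+ c ℚ.* y ℚ.+ d) (ℚP.*-comm F G) (ℚP.+-comm F G)

      F G S : ℕ → ℚ
      F = seq (∑ f)
      G = seq (∑ g)
      S = seq (form f g)

    slopeˡ⇒bounded : left ≤ fromℚ c * ∑ g + fromℚ d → Bounded f g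
    slopeˡ⇒bounded h = ≤-by-slack {fromℚ a * form f g} {bound} ((fromℚ c * ∑ g + fromℚ d) - left)
      (≤⇒0≤- {left} {fromℚ c * ∑ g + fromℚ d} h)
      (λ n → trans (to (S n) (F n) (G n)) (cong (λ z → a ℚ.* S n ℚ.+ ((c ℚ.* G n ℚ.+ d) ℚ.+ ℚ.- 1ℚ ℚ.* z)) (sym (seq-slopeˡ f g n))))

    slopeʳ⇒bounded : right ≤ fromℚ c * ∑ f + fromℚ d → Bounded f g
    slopeʳ⇒bounded h = ≤-by-slack {fromℚ a * form f g} {bound} ((fromℚ c * ∑ f + fromℚ d) - right)
      (≤⇒0≤- {right} {fromℚ c * ∑ f + fromℚ d} h)
      (λ n → trans (swapped (F n) (G n)) (trans (to (S n) (G n) (F n))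
        (cong (λ z → a ℚ.* S n ℚ.+ ((c ℚ.* F n ℚ.+ d) ℚ.+ ℚ.- 1ℚ ℚ.* z)) (sym (seq-slopeʳ f g n)))))

    bounded⇒slopeʳ : Bounded f g → right ≤ fromℚ c * ∑ f + fromℚ d
    bounded⇒slopeʳ h = ≤-by-slack {right} {fromℚ c * ∑ f + fromℚ d} (bound - fromℚ a * form f g)
      (≤⇒0≤- {fromℚ a * form f g} {bound} h)
      (λ n → trans (from (S n) (F n) (G n)) (cong (λ z → z ℚ.+ seq (bound - fromℚ a * form f g) n) (sym (seq-slopeʳ f g n))))

    bounded⇒slopeˡ : Bounded f g → left ≤ fromℚ c * ∑ g + fromℚ d
    bounded⇒slopeˡ h = ≤-by-slack {left} {fromℚ c * ∑ g + fromℚ d} (bound - fromℚ a * form f g)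
      (≤⇒0≤- {fromℚ a * form f g} {bound} h)
      (λ n → trans (from (S n) (G n) (F n)) (cong₂ (λ y z → y ℚ.+ (z ℚ.+ ℚ.- 1ℚ ℚ.* (a ℚ.* S n)))
        (sym (seq-slopeˡ f g n)) (swapped (G n) (F n))))

  bounded-on-cube : (∀ (A B : Vec Bool k) → Bounded (indicator A) (indicator B)) →
    ∀ (f g : Fin k → ℝ) → (∀ i → 0ℝ ≤ f i) → (∀ i → f i ≤ 1ℝ) → (∀ i → 0ℝ ≤ g i) → (∀ i → g i ≤ 1ℝ) → Bounded f g
  bounded-on-cube vertices f g 0≤f f≤1 0≤g g≤1 =
    slopeˡ⇒bounded f g (affine≤-on-cube (λ i → slope g (E i)) (fromℚ c * ∑ g + fromℚ d)
      (λ A → bounded⇒slopeˡ (indicator A) g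
        (slopeʳ⇒bounded (indicator A) g (affine≤-on-cube (λ j → slope (indicator A) (λ i → E i j)) (fromℚ c * ∑ (indicator A) + fromℚ d)
          (λ B → bounded⇒slopeʳ (indicator A) (indicator B) (vertices A B))
          g 0≤g g≤1)))
      f 0≤f f≤1)

-- Counting edges in ℚ

infix 8 ι_

ι_ : ℕ → ℚ
ι n = + n / 1

ι-+ : ∀ m n → ι (m ℕ.+ n) ≡ ι m ℚ.+ ι n
ι-+ m n = ℚP.toℚᵘ-injective
  (ℚᵘP.≃-trans (toℚᵘ-/ (+ (m ℕ.+ n)) 0)
  (ℚᵘP.≃-trans (ℚᵘ.*≡* (arith (+ m) (+ n)))
  (ℚᵘP.≃-trans (ℚᵘP.≃-sym (ℚᵘP.+-cong (toℚᵘ-/ (+ m) 0) (toℚᵘ-/ (+ n) 0)))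
               (ℚᵘP.≃-sym (ℚP.toℚᵘ-homo-+ (ι m) (ι n))))))
  where
  arith : ∀ i j → (i ℤ.+ j) ℤ.* (+ 1) ≡ (i ℤ.* + 1 ℤ.+ j ℤ.* + 1) ℤ.* + 1
  arith = ℤSolver.solve-∀

ι-* : ∀ m n → ι (m ℕ.* n) ≡ ι m ℚ.* ι n
ι-* m n = ℚP.toℚᵘ-injective
  (ℚᵘP.≃-trans (toℚᵘ-/ (+ (m ℕ.* n)) 0)
  (ℚᵘP.≃-trans (ℚᵘ.*≡* (cong (ℤ._* + 1) (ℤP.pos-* m n)))
  (ℚᵘP.≃-trans (ℚᵘP.≃-sym (ℚᵘP.*-cong (toℚᵘ-/ (+ m) 0) (toℚᵘ-/ (+ n) 0)))
               (ℚᵘP.≃-sym (ℚP.toℚᵘ-homo-* (ι m) (ι n))))))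

ι-mono-≤ : ∀ {m n} → m ℕ.≤ n → ι m ℚ.≤ ι n
ι-mono-≤ {m} {n} m≤n = ℚP.toℚᵘ-cancel-≤
  (ℚᵘP.≤-respˡ-≃ (ℚᵘP.≃-sym (toℚᵘ-/ (+ m) 0))
    (ℚᵘP.≤-respʳ-≃ (ℚᵘP.≃-sym (toℚᵘ-/ (+ n) 0))
      (ℚᵘ.*≤* (ℤP.*-monoʳ-≤-nonNeg (+ 1) (ℤ.+≤+ m≤n)))))

direction : ∀ {k} → Orientation k → Fin k → Fin k → Bool
direction (v ∷ t) zero    zero    = false
direction (v ∷ t) zero    (suc j) = lookup v j
direction (v ∷ t) (suc i) zero    = not (lookup v i)
direction (v ∷ t) (suc i) (suc j) = direction t i j

toTournament : ∀ {k} → Orientation k → Tournament k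
toTournament t = record { edge = direction t ; irreflexive = irr t ; oriented = ori t }
  where
  irr : ∀ {k} (t : Orientation k) i → direction t i i ≡ false
  irr (v ∷ t) zero    = refl
  irr (v ∷ t) (suc i) = irr t i
  ori : ∀ {k} (t : Orientation k) i j → i ≢ j → direction t j i ≡ not (direction t i j)
  ori (v ∷ t) zero    zero    i≢j = contradiction refl i≢j
  ori (v ∷ t) zero    (suc j) i≢j = refl
  ori (v ∷ t) (suc i) zero    i≢j = sym (not-involutive (lookup v i))
  ori (v ∷ t) (suc i) (suc j) i≢j = ori t i j (λ i≡j → i≢j (cong suc i≡j))

bit : Bool → ℚ
bit b = if b then 1ℚ else 0ℚ

sum-bits : ∀ {k} (A : Vec Bool k) → sum (λ i → bit (lookup A i)) ≡ ι size A
sum-bits []      = refl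
sum-bits (a ∷ A) = trans (cong₂ ℚ._+_ (bit≡ι a) (sum-bits A)) (sym (ι-+ ⟦ a ⟧ (size A)))
  where
  bit≡ι : ∀ b → bit b ≡ ι ⟦ b ⟧
  bit≡ι true  = refl
  bit≡ι false = refl

cell-bits : ∀ a b x → (if x then bit a ℚ.* bit b else 0ℚ) ≡ ι ⟦ (a ∧ b) ∧ x ⟧
cell-bits true  true  true  = refl
cell-bits true  true  false = refl
cell-bits true  false true  = refl
cell-bits true  false false = refl
cell-bits false true  true  = refl
cell-bits false true  false = refl
cell-bits false false true  = refl
cell-bits false false false = refl

row-bits : ∀ {k} (v : Vec Bool k) a b (A B : Vec Bool k) →
  sum (λ j → if lookup v j then bit a ℚ.* bit (lookup B j) else 0ℚ) ℚ.+
  sum (λ i → if not (lookup v i) then bit (lookup A i) ℚ.* bit b else 0ℚ) ≡ ι rowCount id v a b A B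
row-bits []      a b []       []       = refl
row-bits (x ∷ v) a b (a′ ∷ A) (b′ ∷ B) = begin
  (p ℚ.+ P) ℚ.+ (q ℚ.+ Q)  ≡⟨ interchange p P q Q ⟩
  (p ℚ.+ q) ℚ.+ (P ℚ.+ Q)  ≡⟨ cong₂ ℚ._+_ (cong₂ ℚ._+_ (cell-bits a b′ x) (cell-bits a′ b (not x))) (row-bits v a b A B) ⟩
  (ι m ℚ.+ ι n) ℚ.+ ι r    ≡⟨ cong (ℚ._+ ι r) (ι-+ m n) ⟨
  ι (m ℕ.+ n) ℚ.+ ι r      ≡⟨ ι-+ (m ℕ.+ n) r ⟨
  ι (m ℕ.+ n ℕ.+ r)        ∎
  where
  open ≡-Reasoning
  m = ⟦ (a ∧ b′) ∧ x ⟧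
  n = ⟦ (a′ ∧ b) ∧ not x ⟧
  r = rowCount id v a b A B
  p = if x then bit a ℚ.* bit b′ else 0ℚ
  q = if not x then bit a′ ℚ.* bit b else 0ℚ
  P = sum (λ j → if lookup v j then bit a ℚ.* bit (lookup B j) else 0ℚ)
  Q = sum (λ i → if not (lookup v i) then bit (lookup A i) ℚ.* bit b else 0ℚ)
  interchange : ∀ a b c d → (a ℚ.+ b) ℚ.+ (c ℚ.+ d) ≡ (a ℚ.+ c) ℚ.+ (b ℚ.+ d)
  interchange = solve 4 (λ a b c d → (a :+ b) :+ (c :+ d) := (a :+ c) :+ (b :+ d)) refl

form-bits : ∀ {k} (t : Orientation k) (A B : Vec Bool k) →
  sum (λ i → sum (λ j → if direction t i j then bit (lookup A i) ℚ.* bit (lookup B j) else 0ℚ)) ≡ ι forward t A B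
form-bits []      []      []      = refl
form-bits (v ∷ t) (a ∷ A) (b ∷ B) = begin
  (0ℚ ℚ.+ sum P) ℚ.+ sum (λ i → Q i ℚ.+ S i)
    ≡⟨ cong₂ ℚ._+_ (ℚP.+-identityˡ (sum P)) (∑-distrib-+ Q S) ⟩
  sum P ℚ.+ (sum Q ℚ.+ sum S)
    ≡⟨ ℚP.+-assoc (sum P) (sum Q) (sum S) ⟨
  sum P ℚ.+ sum Q ℚ.+ sum S
    ≡⟨ cong₂ ℚ._+_ (row-bits v a b A B) (form-bits t A B) ⟩
  ι rowCount id v a b A B ℚ.+ ι forward t A B
    ≡⟨ ι-+ (rowCount id v a b A B) (forward t A B) ⟨
  ι (rowCount id v a b A B ℕ.+ forward t A B) ∎
  where
  open ≡-Reasoning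
  P Q S : Fin _ → ℚ
  P j = if lookup v j then bit a ℚ.* bit (lookup B j) else 0ℚ
  Q i = if not (lookup v i) then bit (lookup A i) ℚ.* bit b else 0ℚ
  S i = sum (λ j → if direction t i j then bit (lookup A i) ℚ.* bit (lookup B j) else 0ℚ)

module _ {k : ℕ} (t : Orientation k) (a b c d : ℕ)
  (balanced : ∀ (A B : Vec Bool k) → a ℕ.* forward t A B ℕ.≤ b ℕ.* (size A ℕ.* size B) ℕ.+ c ℕ.* (size A ℕ.+ size B) ℕ.+ d) where
  open Bilinear (direction t) (ι a) (ι b) (ι c) (ι d)

  vertices-bounded : ∀ (A B : Vec Bool k) → Bounded (indicator A) (indicator B)
  vertices-bounded A B = ≤-resp-pointwise
    {fromℚ (ι (a ℕ.* forward t A B))} {fromℚ (ι a) * form (indicator A) (indicator B)}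
    {fromℚ (ι (b ℕ.* (size A ℕ.* size B) ℕ.+ c ℕ.* (size A ℕ.+ size B) ℕ.+ d))}
    {fromℚ (ι b) * (∑ (indicator A) * ∑ (indicator B)) + fromℚ (ι c) * (∑ (indicator A) + ∑ (indicator B)) + fromℚ (ι d)}
    (λ n → trans (ι-* a _) (cong (ι a ℚ.*_) (sym (trans (seq-form (indicator A) (indicator B) n) (form-bits t A B)))))
    (λ n → begin
      ι (b ℕ.* (size A ℕ.* size B) ℕ.+ c ℕ.* (size A ℕ.+ size B) ℕ.+ d)
        ≡⟨ ι-+ (b ℕ.* (size A ℕ.* size B) ℕ.+ c ℕ.* (size A ℕ.+ size B)) d ⟩
      ι (b ℕ.* (size A ℕ.* size B) ℕ.+ c ℕ.* (size A ℕ.+ size B)) ℚ.+ ι d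
        ≡⟨ cong (ℚ._+ ι d) (ι-+ (b ℕ.* (size A ℕ.* size B)) (c ℕ.* (size A ℕ.+ size B))) ⟩
      ι (b ℕ.* (size A ℕ.* size B)) ℚ.+ ι (c ℕ.* (size A ℕ.+ size B)) ℚ.+ ι d
        ≡⟨ cong₂ (λ y z → y ℚ.+ z ℚ.+ ι d)
             (trans (ι-* b (size A ℕ.* size B)) (cong (ι b ℚ.*_) (ι-* (size A) (size B))))
             (trans (ι-* c (size A ℕ.+ size B)) (cong (ι c ℚ.*_) (ι-+ (size A) (size B)))) ⟩
      ι b ℚ.* (ι size A ℚ.* ι size B) ℚ.+ ι c ℚ.* (ι size A ℚ.+ ι size B) ℚ.+ ι d
        ≡⟨ cong₂ (λ y z → ι b ℚ.* (y ℚ.* z) ℚ.+ ι c ℚ.* (y ℚ.+ z) ℚ.+ ι d) (total A n) (total B n) ⟩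
      ι b ℚ.* (seq (∑ (indicator A)) n ℚ.* seq (∑ (indicator B)) n) ℚ.+
        ι c ℚ.* (seq (∑ (indicator A)) n ℚ.+ seq (∑ (indicator B)) n) ℚ.+ ι d ∎)
    (fromℚ-mono-≤ (ι-mono-≤ (balanced A B)))
    where
    open ≡-Reasoning
    total : ∀ (A : Vec Bool k) n → ι size A ≡ seq (∑ (indicator A)) n
    total A n = sym (trans (seq-∑ (indicator A) n) (sum-bits A))

-- Lower bound for the logarithm

-- The harmonic number of n + 1 minus 1, which is the right-endpoint sum for log (n + 1) with unit
-- steps.
harmonic : ℕ → ℚ
harmonic n = ∑< n (λ j → recip (2 ℕ.+ j))

-- Oresme's argument: the m + 1 new terms are each at least 1 / (2 m + 2).
harmonic-double : ∀ m → harmonic m ℚ.+ ½ ℚ.≤ harmonic (m ℕ.+ suc m)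
harmonic-double m = begin
  harmonic m ℚ.+ ½
    ≡⟨ cong (harmonic m ℚ.+_) (∑<-recip-* m 1) ⟨
  harmonic m ℚ.+ ∑< (suc m) (λ _ → recip (2 ℕ.* suc m))
    ≤⟨ ℚP.+-monoʳ-≤ (harmonic m) (∑<-mono (suc m) (λ i i<1+m →
         recip-antitone (2 ℕ.+ (m ℕ.+ i)) (2 ℕ.* suc m) (le i i<1+m))) ⟩
  harmonic m ℚ.+ ∑< (suc m) (λ i → recip (2 ℕ.+ (m ℕ.+ i)))
    ≡⟨ ∑<-+ m (suc m) (λ j → recip (2 ℕ.+ j)) ⟨
  harmonic (m ℕ.+ suc m) ∎
  where
  open ℚP.≤-Reasoning
  eq : ∀ m → 2 ℕ.+ (m ℕ.+ m) ≡ 2 ℕ.* (1 ℕ.+ m)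
  eq = ℕSolver.solve-∀
  le : ∀ i → i ℕ.< suc m → 2 ℕ.+ (m ℕ.+ i) ℕ.≤ 2 ℕ.* suc m
  le i (s≤s i≤m) = ℕP.≤-trans (ℕP.+-monoʳ-≤ 2 (ℕP.+-monoʳ-≤ m i≤m)) (ℕP.≤-reflexive (eq m))

harmonic-mono : ∀ {m n} → m ℕ.≤ n → harmonic m ℚ.≤ harmonic n
harmonic-mono {m} {n} m≤n = begin
  harmonic m                                             ≡⟨ ℚP.+-identityʳ (harmonic m) ⟨
  harmonic m ℚ.+ 0ℚ                                      ≤⟨ ℚP.+-monoʳ-≤ (harmonic m) (nonneg d) ⟩
  harmonic m ℚ.+ ∑< d (λ j → recip (2 ℕ.+ (m ℕ.+ j)))    ≡⟨ ∑<-+ m d (λ j → recip (2 ℕ.+ j)) ⟨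
  harmonic (m ℕ.+ d)                                     ≡⟨ cong harmonic (ℕP.m+[n∸m]≡n m≤n) ⟩
  harmonic n                                             ∎
  where
  open ℚP.≤-Reasoning
  d = n ℕ.∸ m
  nonneg : ∀ d → 0ℚ ℚ.≤ ∑< d (λ j → recip (2 ℕ.+ (m ℕ.+ j)))
  nonneg zero    = ℚP.≤-refl
  nonneg (suc d) = ℚP.+-mono-≤ (nonneg d) (recip-nonNeg (2 ℕ.+ (m ℕ.+ d)))

harmonic-2^ : ∀ j m → suc m ≡ 2 ℕ.^ j → ι j ℚ.* ½ ℚ.≤ harmonic m
harmonic-2^ zero    zero    _  = ℚP.≤-refl
harmonic-2^ zero    (suc m) ()
harmonic-2^ (suc j) m 1+m≡2^ with 2 ℕ.^ j in eq
... | zero   = contradiction 1+m≡2^ (λ ())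
... | suc m′ = begin
  ι suc j ℚ.* ½                 ≡⟨ cong (ℚ._* ½) (ι-+ 1 j) ⟩
  (1ℚ ℚ.+ ι j) ℚ.* ½            ≡⟨ split (ι j) ⟩
  ι j ℚ.* ½ ℚ.+ ½               ≤⟨ ℚP.+-monoˡ-≤ ½ (harmonic-2^ j m′ (sym eq)) ⟩
  harmonic m′ ℚ.+ ½             ≤⟨ harmonic-double m′ ⟩
  harmonic (m′ ℕ.+ suc m′)      ≡⟨ cong harmonic (ℕP.suc-injective (trans 1+m≡2^ (double m′))) ⟨
  harmonic m                    ∎
  where
  open ℚP.≤-Reasoning
  split : ∀ p → (1ℚ ℚ.+ p) ℚ.* ½ ≡ p ℚ.* ½ ℚ.+ ½
  split = solve 1 (λ p → (con 1ℚ :+ p) :* con ½ := p :* con ½ :+ con ½) refl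
  double : ∀ m → 2 ℕ.* (1 ℕ.+ m) ≡ 1 ℕ.+ (m ℕ.+ (1 ℕ.+ m))
  double = ℕSolver.solve-∀

-- A right-endpoint sum lies below every left-endpoint sum, so unit steps suffice. The factor ½
-- stands in for log 2; the size of x leaves room for this loss.
log-lower-bound : ∀ j k → 2 ℕ.^ j ℕ.≤ k → fromℚ (ι j ℚ.* ½) ≤ log k
log-lower-bound j k 2^j≤k = pointwise-≤ {fromℚ (ι j ℚ.* ½)} {log k} λ n → begin
  ι j ℚ.* ½                        ≤⟨ harmonic-2^ j (2 ℕ.^ j ℕ.∸ 1) (ℕP.m+[n∸m]≡n (ℕP.m^n>0 2 j)) ⟩
  harmonic (2 ℕ.^ j ℕ.∸ 1)         ≤⟨ harmonic-mono (ℕP.≤-trans (ℕP.∸-monoˡ-≤ 1 2^j≤k) (ℕP.≤-reflexive (sym (ℕP.*-identityʳ (k ℕ.∸ 1))))) ⟩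
  riemannʳ k 0                     ≤⟨ riemannʳ≤riemann k 0 n ⟩
  riemann k n                      ∎
  where open ℚP.≤-Reasoning

-- An integer substitute for the binary logarithm: the lower bracket serves `log-lower-bound`, the
-- upper one the discount in `quasirandom`, and `1 ≤ j` absorbs constant errors in
-- `quadratic-estimate`.
dyadic-bracket : ∀ k → 2 ℕ.≤ k → ∃[ j ] (1 ℕ.≤ j × 2 ℕ.^ j ℕ.≤ k × k ℕ.≤ 2 ℕ.^ suc j)
dyadic-bracket (suc (suc zero))    (s≤s (s≤s z≤n)) = 1 , ℕP.≤-refl , ℕP.≤-refl , s≤s (s≤s z≤n)
dyadic-bracket (suc k@(suc (suc _))) (s≤s (s≤s z≤n)) with dyadic-bracket k (s≤s (s≤s z≤n))
... | j , 1≤j , 2^j≤k , k≤2^ with suc k ℕP.≤? 2 ℕ.^ suc j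
...   | yes 1+k≤2^ = j , 1≤j , ℕP.m≤n⇒m≤1+n 2^j≤k , 1+k≤2^
...   | no  1+k≰2^ = suc j , s≤s z≤n , ℕP.<⇒≤ (ℕP.≰⇒> 1+k≰2^) , (begin
  1 ℕ.+ k                            ≤⟨ ℕP.+-mono-≤ (ℕP.m^n>0 2 (suc j)) k≤2^ ⟩
  2 ℕ.^ suc j ℕ.+ 2 ℕ.^ suc j        ≡⟨ cong (2 ℕ.^ suc j ℕ.+_) (ℕP.+-identityʳ (2 ℕ.^ suc j)) ⟨
  2 ℕ.^ suc (suc j)                  ∎)
  where open ℕP.≤-Reasoning

-- The final estimate

record ℝ≥0 : Set where
  constructor _≥0∶_
  field
    value  : ℝ
    nonneg : 0ℝ ≤ value

open ℝ≥0

infixl 6 _⊞_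
infixl 7 _⊠_ _·_

_⊞_ _⊠_ : ℝ≥0 → ℝ≥0 → ℝ≥0
(x ≥0∶ 0≤x) ⊞ (y ≥0∶ 0≤y) = (x + y) ≥0∶ +-nonneg {x} {y} 0≤x 0≤y
(x ≥0∶ 0≤x) ⊠ (y ≥0∶ 0≤y) = (x * y) ≥0∶ *-nonneg {x} {y} 0≤x 0≤y

constant : (c : ℚ) → .{{ℚ.NonNegative c}} → ℝ≥0
constant c = fromℚ c ≥0∶ fromℚ-mono-≤ (ℚP.nonNegative⁻¹ c)

_·_ : (c : ℚ) → .{{ℚ.NonNegative c}} → ℝ≥0 → ℝ≥0
c · y = constant c ⊠ y

difference : (x y : ℝ) → x ≤ y → ℝ≥0
difference x y x≤y = (y - x) ≥0∶ ≤⇒0≤- {x} {y} x≤y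

-- After multiplication by 101 the target is 51.51 x². The part 51 x² covers 51 F G, and 0.51 x² ≥
-- 12750000 x J remains. The linear error is at most 20000 (3 + J) x, which leaves 12730000 x (J -
-- 1) + 12670000 x; as x ≥ 25000000, this exceeds the constant 20000.
quadratic-estimate : ∀ (S F G x J : ℝ) →
  fromℚ (ι 101) * S ≤ fromℚ (ι 51) * (F * G) + (fromℚ (ι 10000) * (fromℚ (ι 3) + J)) * (F + G) + fromℚ (ι 20000) →
  0ℝ ≤ F → F + G ≤ fromℚ (ι 2) * x → fromℚ (ι 25000000) * J ≤ x → 1ℝ ≤ J →
  S ≤ fromℚ (+ 51 / 100) * (x * x)
quadratic-estimate S F G x J bound 0≤F F+G≤2x 25e6J≤x 1≤J =
  ≤-by-slack {S} {fromℚ (+ 51 / 100) * (x * x)} (value slack) (nonneg slack)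
    (λ n → identity (seq S n) (seq F n) (seq G n) (seq x n) (seq J n))
  where
  F⁺ [x-F]² 2x-F-G x-25e6J J-1 x⁺ slack : ℝ≥0
  F⁺ = F ≥0∶ 0≤F
  [x-F]² = ((x - F) * (x - F)) ≥0∶ square-nonneg (x - F)
  2x-F-G = difference (F + G) (fromℚ (ι 2) * x) F+G≤2x
  x-25e6J = difference (fromℚ (ι 25000000) * J) x 25e6J≤x
  J-1 = difference 1ℝ J 1≤J
  -- The sign of x comes from x ≥ 25000000 J and J ≥ 1.
  x⁺ = x ≥0∶ ≤-by-slack {0ℝ} {x} (value x′) (nonneg x′) (λ n → eq (seq x n) (seq J n) (ι 25000000))
    where
    x′ = x-25e6J ⊞ ι 25000000 · (J-1 ⊞ constant 1ℚ)
    eq : ∀ x J m → x ≡ 0ℚ ℚ.+ ((x ℚ.+ ℚ.- 1ℚ ℚ.* (m ℚ.* J)) ℚ.+ m ℚ.* (J ℚ.+ ℚ.- 1ℚ ℚ.* 1ℚ ℚ.+ 1ℚ))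
    eq = solve 3 (λ x J m → x := con 0ℚ :+ ((x :+ con (ℚ.- 1ℚ) :* (m :* J)) :+ m :* (J :+ con (ℚ.- 1ℚ) :* con 1ℚ :+ con 1ℚ))) refl
  -- This uses x² - F G = (x - F)² + F (2x - F - G).
  slack = + 1 / 101 ·
    (difference (fromℚ (ι 101) * S) (fromℚ (ι 51) * (F * G) + (fromℚ (ι 10000) * (fromℚ (ι 3) + J)) * (F + G) + fromℚ (ι 20000)) bound
     ⊞ ι 51 · ([x-F]² ⊞ F⁺ ⊠ 2x-F-G)
     ⊞ ι 10000 · (2x-F-G ⊠ (J-1 ⊞ constant (ι 4)))
     ⊞ + 51 / 100 · (x⁺ ⊠ x-25e6J)
     ⊞ ι 12730000 · (x⁺ ⊠ J-1)
     ⊞ ι 12670000 · (x-25e6J ⊞ ι 25000000 · J-1)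
     ⊞ constant (ι 316749999980000))
  identity : ∀ S F G x J → + 51 / 100 ℚ.* (x ℚ.* x) ≡ S ℚ.+ + 1 / 101 ℚ.*
    ((ι 51 ℚ.* (F ℚ.* G) ℚ.+ ι 10000 ℚ.* (ι 3 ℚ.+ J) ℚ.* (F ℚ.+ G) ℚ.+ ι 20000 ℚ.+ ℚ.- 1ℚ ℚ.* (ι 101 ℚ.* S))
     ℚ.+ ι 51 ℚ.* ((x ℚ.+ ℚ.- 1ℚ ℚ.* F) ℚ.* (x ℚ.+ ℚ.- 1ℚ ℚ.* F) ℚ.+ F ℚ.* (ι 2 ℚ.* x ℚ.+ ℚ.- 1ℚ ℚ.* (F ℚ.+ G)))
     ℚ.+ ι 10000 ℚ.* ((ι 2 ℚ.* x ℚ.+ ℚ.- 1ℚ ℚ.* (F ℚ.+ G)) ℚ.* (J ℚ.+ ℚ.- 1ℚ ℚ.* 1ℚ ℚ.+ ι 4))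
     ℚ.+ + 51 / 100 ℚ.* (x ℚ.* (x ℚ.+ ℚ.- 1ℚ ℚ.* (ι 25000000 ℚ.* J)))
     ℚ.+ ι 12730000 ℚ.* (x ℚ.* (J ℚ.+ ℚ.- 1ℚ ℚ.* 1ℚ))
     ℚ.+ ι 12670000 ℚ.* ((x ℚ.+ ℚ.- 1ℚ ℚ.* (ι 25000000 ℚ.* J)) ℚ.+ ι 25000000 ℚ.* (J ℚ.+ ℚ.- 1ℚ ℚ.* 1ℚ))
     ℚ.+ ι 316749999980000)
  identity = solve 5 (λ S F G x J → con (+ 51 / 100) :* (x :* x) := S :+ con (+ 1 / 101) :*
    ((con (ι 51) :* (F :* G) :+ con (ι 10000) :* (con (ι 3) :+ J) :* (F :+ G) :+ con (ι 20000) :+ con (ℚ.- 1ℚ) :* (con (ι 101) :* S))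
     :+ con (ι 51) :* ((x :+ con (ℚ.- 1ℚ) :* F) :* (x :+ con (ℚ.- 1ℚ) :* F) :+ F :* (con (ι 2) :* x :+ con (ℚ.- 1ℚ) :* (F :+ G)))
     :+ con (ι 10000) :* ((con (ι 2) :* x :+ con (ℚ.- 1ℚ) :* (F :+ G)) :* (J :+ con (ℚ.- 1ℚ) :* con 1ℚ :+ con (ι 4)))
     :+ con (+ 51 / 100) :* (x :* (x :+ con (ℚ.- 1ℚ) :* (con (ι 25000000) :* J)))
     :+ con (ι 12730000) :* (x :* (J :+ con (ℚ.- 1ℚ) :* con 1ℚ))
     :+ con (ι 12670000) :* ((x :+ con (ℚ.- 1ℚ) :* (con (ι 25000000) :* J)) :+ con (ι 25000000) :* (J :+ con (ℚ.- 1ℚ) :* con 1ℚ))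
     :+ con (ι 316749999980000))) refl

-- This is r⁵⁰ + r⁻⁵¹ ≤ 2 multiplied by 10001⁵¹ 10000⁵⁰, checked by evaluation. To second order in h
-- = 1/10000 the sum is 2 - h + 2551 h², so 10000 leaves a comfortable margin.
10001^101+10000^101≤ : 10001 ℕ.^ 101 ℕ.+ 10000 ℕ.^ 101 ≤ℕ 2 ℕ.* (10001 ℕ.^ 51 ℕ.* 10000 ℕ.^ 50)
10001^101+10000^101≤ = ℕP.≤ᵇ⇒≤ _ _ _

quasirandom : ∀ k j .{{_ : ℕ.NonZero k}} → k ≤ℕ 2 ℕ.^ ℕ.suc j → ∃[ t ] (∀ (A B : Vec Bool k) →
  101 ℕ.* forward t A B ≤ℕ 51 ℕ.* (size A ℕ.* size B) ℕ.+ (10000 ℕ.* (3 ℕ.+ j)) ℕ.* (size A ℕ.+ size B) ℕ.+ 20000)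
quasirandom k j k≤2^ =
  -- The exponent 3 + j comes from 4 k ≤ 4 times the (j + 1)-st power of 2.
  let t , balanced = Orientations.balancedOrientation 10000 50 _ 10001^101+10000^101≤ k (3 ℕ.+ j) 4k≤
  in t , λ A B → ℕP.≤-trans (balanced A B) (ℕP.≤-reflexive (rearrange (size A) (size B) j))
  where
  quadruple : ∀ m → 4 ℕ.* (2 ℕ.* m) ≡ 2 ℕ.* (2 ℕ.* (2 ℕ.* m))
  quadruple = ℕSolver.solve-∀
  4k≤ : 4 ℕ.* k ≤ℕ 2 ℕ.^ (3 ℕ.+ j)
  4k≤ = ℕP.≤-trans (ℕP.*-monoʳ-≤ 4 k≤2^) (ℕP.≤-reflexive (quadruple (2 ℕ.^ j)))
  regroup : ∀ M q a b l → M ℕ.+ q ℕ.* (2 ℕ.+ l ℕ.* (a ℕ.+ b)) ≡ M ℕ.+ (q ℕ.* l) ℕ.* (a ℕ.+ b) ℕ.+ q ℕ.* 2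
  regroup = ℕSolver.solve-∀
  rearrange : ∀ a b j → 51 ℕ.* (a ℕ.* b) ℕ.+ 10000 ℕ.* (2 ℕ.+ (3 ℕ.+ j) ℕ.* (a ℕ.+ b)) ≡
    51 ℕ.* (a ℕ.* b) ℕ.+ (10000 ℕ.* (3 ℕ.+ j)) ℕ.* (a ℕ.+ b) ℕ.+ 20000
  rearrange a b j = regroup (51 ℕ.* (a ℕ.* b)) 10000 a b (3 ℕ.+ j)

-- The constant is 10⁸ / 4: one half from the hypothesis on x, the other from log k ≥ j / 2.
log-threshold : ∀ k j x → 2 ℕ.^ j ≤ℕ k → (fromℚ (+ (10 ^ℕ 8) / 1) * log k) * fromℚ ½ ≤ x → fromℚ (ι 25000000) * fromℚ (ι j) ≤ x
log-threshold k j x 2^j≤k threshold =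
  ≤-by-slack {fromℚ (ι 25000000) * fromℚ (ι j)} {x} (value slack) (nonneg slack) (λ n → identity (seq x n) (seq (log k) n) (ι j))
  where
  slack : ℝ≥0
  slack = difference ((fromℚ (+ (10 ^ℕ 8) / 1) * log k) * fromℚ ½) x threshold
    ⊞ ι 50000000 · difference (fromℚ (ι j ℚ.* ½)) (log k) (log-lower-bound j k 2^j≤k)
  identity : ∀ x l j → x ≡ ι 25000000 ℚ.* j ℚ.+
    ((x ℚ.+ ℚ.- 1ℚ ℚ.* ((ι (10 ^ℕ 8) ℚ.* l) ℚ.* ½)) ℚ.+ ι 50000000 ℚ.* (l ℚ.+ ℚ.- 1ℚ ℚ.* (j ℚ.* ½)))
  identity = solve 3 (λ x l j → x := con (ι 25000000) :* j :+
    ((x :+ con (ℚ.- 1ℚ) :* ((con (ι (10 ^ℕ 8)) :* l) :* con ½)) :+ con (ι 50000000) :* (l :+ con (ℚ.- 1ℚ) :* (j :* con ½)))) refl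

lemma3p3 : (k : ℕ) → 2 ≤ℕ k → (x : ℝ) → (fromℚ (+ (10 ^ℕ 8) / 1) * log k) * fromℚ ½ ≤ x →
    Σ[ R ∈ Tournament k ]
    ((f g : Fin k → ℝ) →
    (∀ i → 0ℝ ≤ f i) → (∀ i → f i ≤ 1ℝ) →
    (∀ i → 0ℝ ≤ g i) → (∀ i → g i ≤ 1ℝ) →
    (∀ i → f i + g i ≤ 1ℝ) →
    ∑ (λ i → f i + g i) ≃ fromℚ (+ 2 / 1) * x →
    ∑-edges R (λ i j → f i * g j) ≤ fromℚ (+ 51 / 100) * (x * x))
lemma3p3 k 2≤k x threshold =
  let j , 1≤j , 2^j≤k , k≤2^[1+j] = dyadic-bracket k 2≤k
      t , balanced = quasirandom k j {{ℕ.>-nonZero (ℕP.≤-trans (ℕ.s≤s ℕ.z≤n) 2≤k)}} k≤2^[1+j]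
  in toTournament t , λ f g 0≤f f≤1 0≤g g≤1 _ (total≤2x , _) →
    quadratic-estimate (∑-edges (toTournament t) (λ i j → f i * g j)) (∑ f) (∑ g) x (fromℚ (ι j))
      (≤-resp-pointwise
        {fromℚ (ι 101) * ∑-edges (toTournament t) (λ i j → f i * g j)}
        {fromℚ (ι 101) * ∑-edges (toTournament t) (λ i j → f i * g j)}
        {fromℚ (ι 51) * (∑ f * ∑ g) + fromℚ (ι (10000 ℕ.* (3 ℕ.+ j))) * (∑ f + ∑ g) + fromℚ (ι 20000)}
        {fromℚ (ι 51) * (∑ f * ∑ g) + (fromℚ (ι 10000) * (fromℚ (ι 3) + fromℚ (ι j))) * (∑ f + ∑ g) + fromℚ (ι 20000)}
        (λ n → refl)
        (λ n → cong (λ c → ι 51 ℚ.* (seq (∑ f) n ℚ.* seq (∑ g) n) ℚ.+ c ℚ.* (seq (∑ f) n ℚ.+ seq (∑ g) n) ℚ.+ ι 20000)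
          (trans (ι-* 10000 (3 ℕ.+ j)) (cong (ι 10000 ℚ.*_) (ι-+ 3 j))))
        (Bilinear.bounded-on-cube (direction t) (ι 101) (ι 51) (ι (10000 ℕ.* (3 ℕ.+ j))) (ι 20000)
          (vertices-bounded t 101 51 (10000 ℕ.* (3 ℕ.+ j)) 20000 balanced) f g 0≤f f≤1 0≤g g≤1))
      (∑-nonneg 0≤f)
      (≤-resp-pointwise {∑ (λ i → f i + g i)} {∑ f + ∑ g} {fromℚ (+ 2 / 1) * x} {fromℚ (ι 2) * x}
        (seq-∑-+ f g) (λ n → refl) total≤2x)
      (log-threshold k j x 2^j≤k threshold)
      (fromℚ-mono-≤ (ι-mono-≤ 1≤j))
  where
  seq-∑-+ : ∀ (f g : Fin k → ℝ) n → seq (∑ (λ i → f i + g i)) n ≡ seq (∑ f) n ℚ.+ seq (∑ g) n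
  seq-∑-+ f g n = trans (seq-∑ (λ i → f i + g i) n)
    (trans (∑-distrib-+ (λ i → seq (f i) n) (λ i → seq (g i) n)) (sym (cong₂ ℚ._+_ (seq-∑ f n) (seq-∑ g n))))
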